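{- Let $M$ be a matroid on a finite ground set $E$ with a total ordering $<$ on $E$. Then the ordinary Tutte polynomial of $M$ has the expansion $$T_M(x,y) = \sum_{\substack{X\subseteq E \\ E\setminus X \text{ is } (M,<)\text{ -compatible}}} (x-1)^{r(M/X)}\,y^{r^*(M|X)}.$$
   Context: $r(N)$ is the rank of a matroid $N$, and $N^*$ is its dual. $M|X$ is the restriction of $M$ to $X$ (ground set $X$), $M/X$ is the contraction of $M$ by $X$ (ground set $E\setminus X$), and $r^*(M|X)$ denotes the rank of the dual matroid $(M|X)^*$. $X\cup e$ means $X\cup\{e\}$. Compatibility: a set $Y\subseteq E$ is $(M,<)$-compatible if there is no circuit $C$ of $M$ with $Y\cap C=\{\min(C)\}$, where the minimum is with respect to $<$. Tutte polynomial: for a matroid $M$ with set of bases $\mathcal{B}$, $$T_M(x,y) = \sum_{B\in\mathcal{B}} x^{|\mathrm{Int}_M(B)|}\,y^{|\mathrm{Ext}_M(B)|},$$ where, for $X\subseteq E$, $$\mathrm{Int}_M(X) := \{e\in X : (E\setminus X)\cup e \text{ contains a circuit of } M^* \text{ with } e \text{ as its minimal element}\},$$ $$\mathrm{Ext}_M(X) := \{e\in E\setminus X : X\cup e \text{ contains a circuit of } M \text{ with } e \text{ as its minimal element}\}.$$ -}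

module Defs where

open import Algebra.Bundles using (CommutativeRing)
import Data.Bool.Properties as Bool
open import Data.Empty using (⊥-elim)
open import Data.Fin.Base using (Fin)
open import Data.Fin.Properties using (any?)
open import Data.Fin.Subset
open import Data.Fin.Subset.Properties
open import Data.List.Base as List using (List; []; _∷_; _++_; filter; foldr)
open import Data.List.Extrema.Nat using (max)
open import Data.Nat.Base as ℕ using (ℕ; zero; suc; _+_; _≤_)
import Data.Nat.Properties as ℕ
open import Data.Product.Base using (∃; _×_; _,_; proj₁; proj₂)
open import Data.Sum.Base using (_⊎_; inj₁; inj₂; [_,_]′)
open import Data.Vec.Base as Vec using ([]; _∷_; tabulate)
open import Data.Vec.Properties using (≡-dec)
open import Level using (Level)
open import Relation.Binary.Core using (Rel)
open import Relation.Binary.PropositionalEquality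
  using (_≡_; refl; sym; trans; cong; subst)
open import Relation.Binary.Structures using (IsStrictTotalOrder)
open import Relation.Nullary.Decidable
  using (Dec; yes; no; does; ¬?; _×-dec_; _⊎-dec_; decidable-stable)
open import Relation.Nullary.Negation using (¬_)
open import Relation.Unary using (Pred; Decidable)

private
  variable
    n : ℕ
    p c ℓ : Level

⟪_⟫ : {P : Pred (Fin n) p} → Decidable P → Subset n
⟪ P? ⟫ = tabulate (λ e → does (P? e))

subsets : ∀ n → List (Subset n)
subsets zero    = [] ∷ []
subsets (suc n) = List.map (outside ∷_) (subsets n) ++ List.map (inside ∷_) (subsets n)

∣p∣≡∣p∩q∣+∣p─q∣ : ∀ (p q : Subset n) → ∣ p ∣ ≡ ∣ p ∩ q ∣ + ∣ p ─ q ∣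
∣p∣≡∣p∩q∣+∣p─q∣ []            []            = refl
∣p∣≡∣p∩q∣+∣p─q∣ (outside ∷ p) (outside ∷ q) = ∣p∣≡∣p∩q∣+∣p─q∣ p q
∣p∣≡∣p∩q∣+∣p─q∣ (outside ∷ p) (inside  ∷ q) = ∣p∣≡∣p∩q∣+∣p─q∣ p q
∣p∣≡∣p∩q∣+∣p─q∣ (inside  ∷ p) (inside  ∷ q) = cong suc (∣p∣≡∣p∩q∣+∣p─q∣ p q)
∣p∣≡∣p∩q∣+∣p─q∣ (inside  ∷ p) (outside ∷ q) =
  trans (cong suc (∣p∣≡∣p∩q∣+∣p─q∣ p q)) (sym (ℕ.+-suc _ _))

x∈p─q⇒x∉q : ∀ (p q : Subset n) {x} → x ∈ p ─ q → x ∉ q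
x∈p─q⇒x∉q (_ ∷ _) (inside ∷ _) () Vec.here
x∈p─q⇒x∉q (_ ∷ p) (_ ∷ q) (Vec.there x∈) (Vec.there x∈q) = x∈p─q⇒x∉q p q x∈ x∈q

disjoint⇒∣p∣+∣q∣≤∣r∣ : ∀ (p q r : Subset n) → p ⊆ r → q ⊆ r →
                       (∀ {x} → x ∈ q → x ∉ p) → ∣ p ∣ + ∣ q ∣ ≤ ∣ r ∣
disjoint⇒∣p∣+∣q∣≤∣r∣ p q r p⊆r q⊆r disj =
  subst (∣ p ∣ + ∣ q ∣ ≤_) (sym (∣p∣≡∣p∩q∣+∣p─q∣ r p))
    (ℕ.+-mono-≤ (p⊆q⇒∣p∣≤∣q∣ (λ x∈p → x∈p∩q⁺ (p⊆r x∈p , x∈p)))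
                (p⊆q⇒∣p∣≤∣q∣ (λ x∈q → x∈p∧x∉q⇒x∈p─q (q⊆r x∈q) (disj x∈q))))

-- The ground set is a subset of the ambient `Fin n`, so that minors and duals
-- of a matroid live over the same `n`.
record Matroid (n : ℕ) : Set₁ where
  field
    E        : Subset n
    Indep    : Subset n → Set
    indep?   : Decidable Indep
    indep⊆E  : ∀ {I} → Indep I → I ⊆ E
    indep-⊥  : Indep ⊥
    indep-⊆  : ∀ {I J} → I ⊆ J → Indep J → Indep I
    augment  : ∀ {I J} → Indep I → Indep J → ∣ I ∣ ℕ.< ∣ J ∣ →
               ∃ λ e → e ∈ J × e ∉ I × Indep (I ∪ ⁅ e ⁆)

  Base : Subset n → Set
  Base B = Indep B × ¬ ∃ λ I → Indep I × B ⊂ I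

  base? : Decidable Base
  base? B = indep? B ×-dec ¬? (anySubset? (λ I → indep? I ×-dec B ⊂? I))

  Circuit : Subset n → Set
  Circuit C = C ⊆ E × ¬ Indep C × ¬ ∃ λ D → ¬ Indep D × D ⊂ C

  circuit? : Decidable Circuit
  circuit? C = C ⊆? E ×-dec ¬? (indep? C)
    ×-dec ¬? (anySubset? (λ D → ¬? (indep? D) ×-dec D ⊂? C))

  rank : ℕ
  rank = max 0 (List.map ∣_∣ (filter indep? (subsets n)))

  I⊂I∪e : ∀ {I e} → e ∉ I → I ⊂ I ∪ ⁅ e ⁆
  I⊂I∪e {I} {e} e∉I =
    p⊆p∪q ⁅ e ⁆ , e , x∈p∪q⁺ (inj₂ (x∈⁅x⁆ e)) , e∉I

  ∣indep∣≤∣base∣ : ∀ {I B} → Indep I → Base B → ∣ I ∣ ≤ ∣ B ∣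
  ∣indep∣≤∣base∣ iI (iB , maximal) = ℕ.≮⇒≥ λ ∣B∣<∣I∣ →
    let e , _ , e∉B , iB∪e = augment iB iI ∣B∣<∣I∣
    in maximal (_ , iB∪e , I⊂I∪e e∉B)

  ∣base∣≤∣indep∣⇒base : ∀ {I B} → Base B → Indep I → ∣ B ∣ ≤ ∣ I ∣ → Base I
  ∣base∣≤∣indep∣⇒base bB iI ∣B∣≤∣I∣ = iI , λ (J , iJ , I⊂J) →
    ℕ.<⇒≱ (p⊂q⇒∣p∣<∣q∣ I⊂J) (ℕ.≤-trans (∣indep∣≤∣base∣ iJ bB) ∣B∣≤∣I∣)

  base-exists : ∃ Base
  base-exists = go n indep-⊥ (ℕ.m≤n+m n _)
    where
    go : ∀ k {I} → Indep I → n ≤ ∣ I ∣ + k → ∃ Base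
    go k {I} iI n≤ with anySubset? (λ J → indep? J ×-dec I ⊂? J)
    ... | no maximal = I , iI , maximal
    go zero {I} iI n≤ | yes (J , iJ , I⊂J) = ⊥-elim
      (ℕ.<⇒≱ (p⊂q⇒∣p∣<∣q∣ I⊂J)
        (ℕ.≤-trans (∣p∣≤n J) (subst (n ≤_) (ℕ.+-identityʳ _) n≤)))
    go (suc k) {I} iI n≤ | yes (J , iJ , I⊂J) = go k iJ
      (ℕ.≤-trans (subst (n ≤_) (ℕ.+-suc _ k) n≤) (ℕ.+-monoˡ-≤ k (p⊂q⇒∣p∣<∣q∣ I⊂J)))

  extend : ∀ {I B} → Indep I → Base B → ∃ λ B′ → Base B′ × I ⊆ B′ × B′ ⊆ I ∪ B
  extend {I} {B} iI bB = go ∣ B ∣ iI (λ x∈I → x∈I) (p⊆p∪q B) (ℕ.m≤n+m _ _)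
    where
    go : ∀ k {K} → Indep K → I ⊆ K → K ⊆ I ∪ B → ∣ B ∣ ≤ ∣ K ∣ + k →
         ∃ λ B′ → Base B′ × I ⊆ B′ × B′ ⊆ I ∪ B
    go zero {K} iK I⊆K K⊆ B≤ = K ,
      ∣base∣≤∣indep∣⇒base bB iK (subst (∣ B ∣ ≤_) (ℕ.+-identityʳ _) B≤) , I⊆K , K⊆
    go (suc k) {K} iK I⊆K K⊆ B≤ with ∣ K ∣ ℕ.<? ∣ B ∣
    ... | no ≮ = K , ∣base∣≤∣indep∣⇒base bB iK (ℕ.≮⇒≥ ≮) , I⊆K , K⊆
    ... | yes K<B =
      let e , e∈B , e∉K , iK∪e = augment iK (proj₁ bB) K<B
      in go k iK∪e (λ x∈I → p⊆p∪q ⁅ e ⁆ (I⊆K x∈I))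
           (λ x∈ → [ K⊆
                   , (λ x∈e → q⊆p∪q I B (subst (_∈ B) (sym (x∈⁅y⁆⇒x≡y e x∈e)) e∈B))
                   ]′ (x∈p∪q⁻ K ⁅ e ⁆ x∈))
           (ℕ.≤-trans (subst (∣ B ∣ ≤_) (ℕ.+-suc _ k) B≤)
                      (ℕ.+-monoˡ-≤ k (p⊂q⇒∣p∣<∣q∣ (I⊂I∪e e∉K))))

open Matroid

infixl 8 _⋆
infixl 7 _↾_ _/_

-- Equivalently, the bases of `M ⋆` are the complements of the bases of `M`.
_⋆ : Matroid n → Matroid n
M ⋆ = record
  { E       = E M
  ; Indep   = λ I → ∃ λ B → Base M B × I ⊆ E M ─ B
  ; indep?  = λ I → anySubset? (λ B → base? M B ×-dec I ⊆? (E M ─ B))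
  ; indep⊆E = λ (B , _ , I⊆) x∈I → p─q⊆p (E M) B (I⊆ x∈I)
  ; indep-⊥ = let B , bB = base-exists M in B , bB , λ x∈⊥ → ⊥-elim (∉⊥ x∈⊥)
  ; indep-⊆ = λ I⊆J (B , bB , J⊆) → B , bB , λ x∈I → J⊆ (I⊆J x∈I)
  ; augment = augment*
  }
  where
  augment* : ∀ {I J} → (∃ λ B → Base M B × I ⊆ E M ─ B) →
             (∃ λ B → Base M B × J ⊆ E M ─ B) → ∣ I ∣ ℕ.< ∣ J ∣ →
             ∃ λ e → e ∈ J × e ∉ I × ∃ λ B → Base M B × I ∪ ⁅ e ⁆ ⊆ E M ─ B
  augment* {I} {J} (B₁ , b₁ , I⊆) (B₂ , b₂ , J⊆) I<J
    with extend M (indep-⊆ M (p─q⊆p B₂ I) (proj₁ b₂)) b₁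
  ... | B , b , B₂─I⊆B , B⊆
    with any? (λ e → e ∈? J ×-dec ¬? (e ∈? I) ×-dec ¬? (e ∈? B))
  ... | yes (e , e∈J , e∉I , e∉B) = e , e∈J , e∉I , B , b , I∪e⊆
    where
    I∪e⊆ : I ∪ ⁅ e ⁆ ⊆ E M ─ B
    I∪e⊆ x∈ with x∈p∪q⁻ I ⁅ e ⁆ x∈
    ... | inj₁ x∈I = x∈p∧x∉q⇒x∈p─q (p─q⊆p (E M) B₁ (I⊆ x∈I)) λ x∈B →
      [ (λ x∈B₂─I → x∈p─q⇒x∉q B₂ I x∈B₂─I x∈I)
      , x∈p─q⇒x∉q (E M) B₁ (I⊆ x∈I)
      ]′ (x∈p∪q⁻ (B₂ ─ I) B₁ (B⊆ x∈B))
    ... | inj₂ x∈e with refl ← x∈⁅y⁆⇒x≡y e x∈e =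
      x∈p∧x∉q⇒x∈p─q (p─q⊆p (E M) B₂ (J⊆ e∈J)) e∉B
  ... | no ∄e = ⊥-elim (ℕ.<⇒≱ I<J ∣J∣≤∣I∣)
    where
    J─I⊆B : J ─ I ⊆ B
    J─I⊆B {x} x∈ = decidable-stable (x ∈? B) λ x∉B →
      ∄e (x , p─q⊆p J I x∈ , x∈p─q⇒x∉q J I x∈ , x∉B)
    J∩B₂ : ∀ {x} → x ∈ J → x ∉ B₂
    J∩B₂ x∈J = x∈p─q⇒x∉q (E M) B₂ (J⊆ x∈J)
    ∣J─I∣≤∣B₂∩I∣ : ∣ J ─ I ∣ ≤ ∣ B₂ ∩ I ∣
    ∣J─I∣≤∣B₂∩I∣ = ℕ.+-cancelʳ-≤ (∣ B₂ ─ I ∣) _ _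
      (ℕ.≤-trans
        (disjoint⇒∣p∣+∣q∣≤∣r∣ (J ─ I) (B₂ ─ I) B J─I⊆B B₂─I⊆B
          (λ x∈B₂─I x∈J─I → J∩B₂ (p─q⊆p J I x∈J─I) (p─q⊆p B₂ I x∈B₂─I)))
        (subst (∣ B ∣ ≤_) (∣p∣≡∣p∩q∣+∣p─q∣ B₂ I) (∣indep∣≤∣base∣ M (proj₁ b) b₂)))
    ∣J∣≤∣I∣ : ∣ J ∣ ≤ ∣ I ∣
    ∣J∣≤∣I∣ = subst (_≤ ∣ I ∣) (sym (∣p∣≡∣p∩q∣+∣p─q∣ J I))
      (ℕ.≤-trans (ℕ.+-monoʳ-≤ (∣ J ∩ I ∣) ∣J─I∣≤∣B₂∩I∣)
        (disjoint⇒∣p∣+∣q∣≤∣r∣ (J ∩ I) (B₂ ∩ I) I (p∩q⊆q J I) (p∩q⊆q B₂ I)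
          (λ x∈B₂∩I x∈J∩I → J∩B₂ (p∩q⊆p J I x∈J∩I) (p∩q⊆p B₂ I x∈B₂∩I))))

_↾_ : Matroid n → Subset n → Matroid n
M ↾ X = record
  { E       = E M ∩ X
  ; Indep   = λ I → Indep M I × I ⊆ X
  ; indep?  = λ I → indep? M I ×-dec I ⊆? X
  ; indep⊆E = λ (iI , I⊆X) x∈I → x∈p∩q⁺ (indep⊆E M iI x∈I , I⊆X x∈I)
  ; indep-⊥ = indep-⊥ M , λ x∈⊥ → ⊥-elim (∉⊥ x∈⊥)
  ; indep-⊆ = λ I⊆J (iJ , J⊆X) → indep-⊆ M I⊆J iJ , λ x∈I → J⊆X (I⊆J x∈I)
  ; augment = λ {I} {J} (iI , I⊆X) (iJ , J⊆X) I<J →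
      let e , e∈J , e∉I , iI∪e = augment M iI iJ I<J
      in e , e∈J , e∉I , iI∪e , λ x∈ →
           [ I⊆X , (λ x∈e → subst (_∈ X) (sym (x∈⁅y⁆⇒x≡y e x∈e)) (J⊆X e∈J)) ]′
             (x∈p∪q⁻ I ⁅ e ⁆ x∈)
  }

_/_ : Matroid n → Subset n → Matroid n
M / X = (M ⋆ ↾ (E M ─ X)) ⋆

module _ {_<_ : Rel (Fin n) p} (isSTO : IsStrictTotalOrder _≡_ _<_) where

  open IsStrictTotalOrder isSTO using (_<?_; _≟_)

  IsMin : Fin n → Subset n → Set p
  IsMin e C = e ∈ C × Lift (λ f → e < f ⊎ e ≡ f) C

  isMin? : ∀ e C → Dec (IsMin e C)
  isMin? e C = e ∈? C ×-dec Lift? (λ f → e <? f ⊎-dec e ≟ f) C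

  Compatible : Matroid n → Subset n → Set p
  Compatible M Y = ¬ ∃ λ C → Circuit M C × ∃ λ e → IsMin e C × Y ∩ C ≡ ⁅ e ⁆

  compatible? : ∀ M → Decidable (Compatible M)
  compatible? M Y = ¬? (anySubset? λ C → circuit? M C
    ×-dec any? λ e → isMin? e C ×-dec ≡-dec Bool._≟_ (Y ∩ C) ⁅ e ⁆)

  HasCircuitWithMin : Matroid n → Subset n → Fin n → Set p
  HasCircuitWithMin M S e = ∃ λ C → Circuit M C × C ⊆ S × IsMin e C

  hasCircuitWithMin? : ∀ M S → Decidable (HasCircuitWithMin M S)
  hasCircuitWithMin? M S e = anySubset? λ C → circuit? M C ×-dec C ⊆? S ×-dec isMin? e C

  Int : Matroid n → Subset n → Subset n
  Int M X = ⟪ (λ e → e ∈? X ×-dec hasCircuitWithMin? (M ⋆) ((E M ─ X) ∪ ⁅ e ⁆) e) ⟫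

  Ext : Matroid n → Subset n → Subset n
  Ext M X = ⟪ (λ e → e ∈? (E M ─ X) ×-dec hasCircuitWithMin? M (X ∪ ⁅ e ⁆) e) ⟫

module _ (R : CommutativeRing c ℓ) where

  private module R = CommutativeRing R
  open import Algebra.Properties.Semiring.Exp R.semiring using (_^_)

  sumOver : {P : Pred (Subset n) p} → Decidable P → (Subset n → R.Carrier) → R.Carrier
  sumOver {n = n} P? f = foldr R._+_ R.0# (List.map f (filter P? (subsets n)))

  -- T_M(x , y) evaluated in R; an identity for all R, x and y is an identity of
  -- polynomials in ℤ[x , y].
  tutte : {_<_ : Rel (Fin n) p} → IsStrictTotalOrder _≡_ _<_ →
          Matroid n → R.Carrier → R.Carrier → R.Carrier
  tutte isSTO M x y = sumOver (base? M) λ B →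
    x ^ ∣ Int isSTO M B ∣ R.* y ^ ∣ Ext isSTO M B ∣

{-# OPTIONS --safe #-}

-- Since x^k = Σ over subsets of a k-set of powers of x − 1, expanding x^|Int B|
-- turns T_M into a sum over pairs of a base B and a set I ⊆ Int B, and such a
-- pair is recorded by X = (B ─ I) ∪ Ext B.  The complement of X is compatible
-- exactly when no e ∉ X lies in the closure of the larger elements of X, and B is
-- recovered from such an X greedily: from X take the elements outside the closure
-- of the larger elements of X, and then add the e ∉ X outside the closure of X
-- and all smaller elements.  B ∩ X is a base of M|X, so r*(M|X) = |Ext B| and
-- r(M/X) = |B ─ X| = |I|.
module Submission where

open import Defs
open import Algebra.Bundles using (CommutativeRing)
import Algebra.Properties.Semiring.Exp as Exp
open import Data.Empty using (⊥-elim)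
open import Data.Fin.Base using (Fin)
open import Data.Fin.Induction using (spo-wellFounded; spo-noetherian)
import Data.Fin.Properties as Fin
open import Data.Fin.Subset renaming (_-_ to _∖_)
open import Data.Fin.Subset.Induction using (⊂-wellFounded)
open import Data.Fin.Subset.Properties renaming (x∈p∧x∉q⇒x∈p─q to x∈X─Y⁺)
open import Data.List.Base as List using (List; []; _∷_; _++_; filter; foldr; concatMap)
open import Data.List.Extrema.Nat using (max≈v⁺)
open import Data.List.Membership.Propositional using () renaming (_∈_ to _∈ₗ_)
open import Data.List.Membership.Propositional.Properties
  using (∈-map⁺; ∈-map⁻; ∈-++⁺ˡ; ∈-++⁺ʳ; ∈-++⁻; ∈-filter⁺; ∈-filter⁻; ∈-concat⁺′; ∈-concat⁻′)
open import Data.List.Membership.Propositional.Properties.WithK using (unique∧set⇒bag)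
open import Data.List.Relation.Binary.BagAndSetEquality using (∼bag⇒↭)
open import Data.List.Relation.Binary.Disjoint.Propositional using (Disjoint)
open import Data.List.Relation.Binary.Permutation.Propositional using (_↭_; ↭⇒↭ₛ)
open import Data.List.Relation.Binary.Permutation.Setoid.Properties using (foldr-commMonoid)
import Data.List.Relation.Binary.Permutation.Setoid.Properties as Permutation
open import Data.List.Relation.Unary.All as All using (All; []; _∷_)
import Data.List.Relation.Unary.All.Properties as All
open import Data.List.Relation.Unary.AllPairs using (AllPairs; []; _∷_)
import Data.List.Relation.Unary.AllPairs.Properties as AllPairs
open import Data.List.Relation.Unary.Any using (here; there)
open import Data.List.Relation.Unary.Unique.Propositional using (Unique)
import Data.List.Relation.Unary.Unique.Propositional.Properties as Unique
open import Data.Nat.Base as ℕ using (ℕ)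
import Data.Nat.Properties as ℕ
open import Data.Product.Base using (∃; _×_; _,_; proj₁; proj₂)
open import Data.Sum.Base using (_⊎_; inj₁; inj₂; [_,_]′)
open import Data.Vec.Base as Vec using ([]; _∷_)
open import Data.Vec.Properties using (∷-injectiveʳ; lookup∘tabulate; []=⇒lookup; lookup⇒[]=)
open import Function.Base using (_∘_; flip)
open import Function.Bundles using (mk⇔)
open import Induction.WellFounded using (Acc; acc)
open import Level using (Level)
open import Relation.Binary.Core using (Rel)
open import Relation.Binary.Definitions using (tri<; tri≈; tri>)
open import Relation.Binary.PropositionalEquality
  using (_≡_; _≢_; refl; sym; trans; cong; cong₂; subst)
  renaming (setoid to ≡-setoid)
open import Relation.Binary.Structures using (IsStrictTotalOrder)
open import Relation.Nullary.Decidable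
  using (Dec; yes; no; ¬?; _×-dec_; _⊎-dec_; decidable-stable; dec-true; dec-false)
open import Relation.Nullary.Negation using (¬_; contradiction)
open import Relation.Unary using (Pred; Decidable)

private
  variable
    n : ℕ
    p : Level
    X Y Z : Subset n
    x y : Fin n

-- Differences and one-element extensions of subsets.

x∈X─Y⁻ : x ∈ X ─ Y → x ∈ X × x ∉ Y
x∈X─Y⁻ {X = X} {Y = Y} x∈ = p─q⊆p X Y x∈ , x∈p─q⇒x∉q X Y x∈

x∈X-y⁻ : x ∈ X ∖ y → x ∈ X × x ≢ y
x∈X-y⁻ {y = y} x∈ = let x∈X , x∉y = x∈X─Y⁻ x∈ in x∈X , λ { refl → x∉y (x∈⁅x⁆ y) }

X∪y⊆Z : X ⊆ Z → y ∈ Z → X ∪ ⁅ y ⁆ ⊆ Z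
X∪y⊆Z {X = X} {y = y} X⊆Z y∈Z x∈ with x∈p∪q⁻ X ⁅ y ⁆ x∈
... | inj₁ x∈X = X⊆Z x∈X
... | inj₂ x∈y with refl ← x∈⁅y⁆⇒x≡y y x∈y = y∈Z

y∈X∪y : y ∈ X ∪ ⁅ y ⁆
y∈X∪y {y = y} {X = X} = q⊆p∪q X ⁅ y ⁆ (x∈⁅x⁆ y)

X-y⊆Z⇒X⊆Z∪y : X ∖ y ⊆ Z → X ⊆ Z ∪ ⁅ y ⁆
X-y⊆Z⇒X⊆Z∪y {y = y} X-y⊆Z {x} x∈X with x Fin.≟ y
... | yes refl = y∈X∪y
... | no x≢y   = p⊆p∪q ⁅ y ⁆ (X-y⊆Z (x∈p∧x≢y⇒x∈p-y x∈X x≢y))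

X⊆Z∪y⇒X-y⊆Z : X ⊆ Z ∪ ⁅ y ⁆ → X ∖ y ⊆ Z
X⊆Z∪y⇒X-y⊆Z {Z = Z} {y = y} X⊆Z∪y {x} x∈ with x∈X-y⁻ x∈
... | x∈X , x≢y with x∈p∪q⁻ Z ⁅ y ⁆ (X⊆Z∪y x∈X)
...   | inj₁ x∈Z = x∈Z
...   | inj₂ x∈y = contradiction (x∈⁅y⁆⇒x≡y y x∈y) x≢y

X-y⊆Z∧y∉X⇒X⊆Z : X ∖ y ⊆ Z → y ∉ X → X ⊆ Z
X-y⊆Z∧y∉X⇒X⊆Z X-y⊆Z y∉X x∈X = X-y⊆Z (x∈p∧x≢y⇒x∈p-y x∈X λ { refl → y∉X x∈X })

∈⟪⟫⁺ : {P : Pred (Fin n) p} (P? : Decidable P) → P x → x ∈ ⟪ P? ⟫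
∈⟪⟫⁺ {x = x} P? px =
  lookup⇒[]= x _ (trans (lookup∘tabulate _ x) (dec-true (P? x) px))

∈⟪⟫⁻ : {P : Pred (Fin n) p} (P? : Decidable P) → x ∈ ⟪ P? ⟫ → P x
∈⟪⟫⁻ {x = x} P? x∈ = decidable-stable (P? x) λ ¬px →
  contradiction (trans (sym ([]=⇒lookup x∈))
                       (trans (lookup∘tabulate _ x) (dec-false (P? x) ¬px)))
                λ ()

-- Intervals of subsets

-- Built coordinate by coordinate, so that every set occurs exactly once and a sum over an interval
-- can be evaluated by induction; the list is empty unless `P ⊆ Q`.
interval : Subset n → Subset n → List (Subset n)
interval []            []            = [] ∷ []
interval (outside ∷ P) (outside ∷ Q) = List.map (outside ∷_) (interval P Q)
interval (outside ∷ P) (inside  ∷ Q) =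
  List.map (outside ∷_) (interval P Q) ++ List.map (inside ∷_) (interval P Q)
interval (inside  ∷ P) (outside ∷ Q) = []
interval (inside  ∷ P) (inside  ∷ Q) = List.map (inside ∷_) (interval P Q)

∈-interval⁺ : ∀ {P Q X : Subset n} → P ⊆ X → X ⊆ Q → X ∈ₗ interval P Q
∈-interval⁺ {P = []} {[]} {[]} _ _ = here refl
∈-interval⁺ {P = outside ∷ P} {outside ∷ Q} {outside ∷ X} P⊆X X⊆Q =
  ∈-map⁺ _ (∈-interval⁺ (drop-∷-⊆ P⊆X) (drop-∷-⊆ X⊆Q))
∈-interval⁺ {P = outside ∷ P} {outside ∷ Q} {inside ∷ X} P⊆X X⊆Q with () ← X⊆Q Vec.here
∈-interval⁺ {P = outside ∷ P} {inside ∷ Q} {outside ∷ X} P⊆X X⊆Q =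
  ∈-++⁺ˡ (∈-map⁺ _ (∈-interval⁺ (drop-∷-⊆ P⊆X) (drop-∷-⊆ X⊆Q)))
∈-interval⁺ {P = outside ∷ P} {inside ∷ Q} {inside ∷ X} P⊆X X⊆Q =
  ∈-++⁺ʳ _ (∈-map⁺ _ (∈-interval⁺ (drop-∷-⊆ P⊆X) (drop-∷-⊆ X⊆Q)))
∈-interval⁺ {P = inside ∷ P} {Q} {outside ∷ X} P⊆X X⊆Q with () ← P⊆X Vec.here
∈-interval⁺ {P = inside ∷ P} {outside ∷ Q} {inside ∷ X} P⊆X X⊆Q with () ← X⊆Q Vec.here
∈-interval⁺ {P = inside ∷ P} {inside ∷ Q} {inside ∷ X} P⊆X X⊆Q =
  ∈-map⁺ _ (∈-interval⁺ (drop-∷-⊆ P⊆X) (drop-∷-⊆ X⊆Q))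

∈-interval⁻ : ∀ (P Q : Subset n) {X} → X ∈ₗ interval P Q → P ⊆ X × X ⊆ Q
∈-interval⁻ [] [] {[]} _ = (λ ()) , (λ ())
∈-interval⁻ (outside ∷ P) (outside ∷ Q) X∈ with ∈-map⁻ _ X∈
... | _ , X∈′ , refl = let P⊆X , X⊆Q = ∈-interval⁻ P Q X∈′ in out⊆ P⊆X , out⊆ X⊆Q
∈-interval⁻ (outside ∷ P) (inside ∷ Q) X∈ with ∈-++⁻ (List.map (outside ∷_) (interval P Q)) X∈
... | inj₁ X∈₁ with ∈-map⁻ _ X∈₁
...   | _ , X∈′ , refl = let P⊆X , X⊆Q = ∈-interval⁻ P Q X∈′ in out⊆ P⊆X , out⊆ X⊆Q
∈-interval⁻ (outside ∷ P) (inside ∷ Q) X∈ | inj₂ X∈₂ with ∈-map⁻ _ X∈₂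
...   | _ , X∈′ , refl = let P⊆X , X⊆Q = ∈-interval⁻ P Q X∈′ in out⊆ P⊆X , in⊆in X⊆Q
∈-interval⁻ (inside ∷ P) (inside ∷ Q) X∈ with ∈-map⁻ _ X∈
... | _ , X∈′ , refl = let P⊆X , X⊆Q = ∈-interval⁻ P Q X∈′ in in⊆in P⊆X , in⊆in X⊆Q

interval-unique : ∀ (P Q : Subset n) → Unique (interval P Q)
interval-unique []            []            = [] ∷ []
interval-unique (outside ∷ P) (outside ∷ Q) = Unique.map⁺ ∷-injectiveʳ (interval-unique P Q)
interval-unique (outside ∷ P) (inside  ∷ Q) =
  Unique.++⁺ (Unique.map⁺ ∷-injectiveʳ (interval-unique P Q))
             (Unique.map⁺ ∷-injectiveʳ (interval-unique P Q))
             disjoint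
  where
  disjoint : Disjoint (List.map (outside ∷_) (interval P Q))
                      (List.map (inside ∷_) (interval P Q))
  disjoint (X∈₁ , X∈₂) with ∈-map⁻ _ X∈₁ | ∈-map⁻ _ X∈₂
  ... | _ , _ , refl | _ , _ , ()
interval-unique (inside  ∷ P) (outside ∷ Q) = []
interval-unique (inside  ∷ P) (inside  ∷ Q) = Unique.map⁺ ∷-injectiveʳ (interval-unique P Q)

subsets≡interval : ∀ n → subsets n ≡ interval ⊥ ⊤
subsets≡interval ℕ.zero    = refl
subsets≡interval (ℕ.suc n) =
  cong (λ Xs → List.map (outside ∷_) Xs ++ List.map (inside ∷_) Xs) (subsets≡interval n)

∈-subsets : ∀ (X : Subset n) → X ∈ₗ subsets n
∈-subsets {n} X = subst (X ∈ₗ_) (sym (subsets≡interval n)) (∈-interval⁺ (⊆-min X) (⊆-max X))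

subsets-unique : ∀ n → Unique (subsets n)
subsets-unique n = subst Unique (sym (subsets≡interval n)) (interval-unique ⊥ ⊤)

-- The maximum defining `rank` is attained at `B` and bounded by it through augmentation. Both ranks
-- in the theorem become cardinalities this way.
rank-base : ∀ (M : Matroid n) {B} → Matroid.Base M B → Matroid.rank M ≡ ∣ B ∣
rank-base M {B} bB = max≈v⁺ (∈-map⁺ ∣_∣ (∈-filter⁺ indep? (∈-subsets B) (proj₁ bB)))
  (All.map⁺ (All.tabulate λ I∈ →
    ∣indep∣≤∣base∣ (proj₂ (∈-filter⁻ indep? {xs = subsets _} I∈)) bB))
  -- The default value 0 of `max` must be bounded by `∣ B ∣` too.
  ℕ.z≤n
  where open Matroid M

-- Circuits, closure and duality

module Circuits (M : Matroid n) where
  open Matroid M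

  circuit-del : ∀ {C e} → Circuit C → e ∈ C → Indep (C ∖ e)
  circuit-del {C} {e} (_ , _ , minimal) e∈C = decidable-stable (indep? (C ∖ e)) λ dep →
    minimal (C ∖ e , dep , x∈p⇒p-x⊂p e∈C)

  dependent⇒circuit : ∀ {D} → D ⊆ E → ¬ Indep D → ∃ λ C → Circuit C × C ⊆ D
  dependent⇒circuit {D} = go D (⊂-wellFounded D)
    where
    go : ∀ D → Acc _⊂_ D → D ⊆ E → ¬ Indep D → ∃ λ C → Circuit C × C ⊆ D
    go D (acc rec) D⊆E dep with anySubset? (λ C → ¬? (indep? C) ×-dec C ⊂? D)
    ... | no minimal = D , (D⊆E , dep , minimal) , λ x∈D → x∈D
    ... | yes (D′ , dep′ , D′⊂D) =
      let C , cC , C⊆D′ = go D′ (rec D′⊂D) (D⊆E ∘ proj₁ D′⊂D) dep′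
      in C , cC , proj₁ D′⊂D ∘ C⊆D′

module Closures (M : Matroid n) where
  open Matroid M
  open Circuits M

  -- The matroid closure, expressed by circuits instead of ranks, to match the circuits in the
  -- definitions of activity and compatibility.
  Closure : Subset n → Fin n → Set
  Closure S e = e ∈ S ⊎ ∃ λ C → Circuit C × e ∈ C × C ∖ e ⊆ S

  closure? : ∀ S e → Dec (Closure S e)
  closure? S e = e ∈? S ⊎-dec anySubset? λ C → circuit? C ×-dec e ∈? C ×-dec (C ∖ e) ⊆? S

  closure-mono : ∀ {S T e} → S ⊆ T → Closure S e → Closure T e
  closure-mono S⊆T (inj₁ e∈S) = inj₁ (S⊆T e∈S)
  closure-mono S⊆T (inj₂ (C , cC , e∈C , C-e⊆S)) = inj₂ (C , cC , e∈C , S⊆T ∘ C-e⊆S)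

  maximal⇒base : ∀ {B} → Indep B → (∀ {x} → x ∉ B → ¬ Indep (B ∪ ⁅ x ⁆)) → Base B
  maximal⇒base iB maximal = iB , λ (I , iI , B⊆I , x , x∈I , x∉B) →
    maximal x∉B (indep-⊆ (X∪y⊆Z B⊆I x∈I) iI)

  -- A circuit inside `I ∪ ⁅ e ⁆` must contain `e`, since `I` is independent.
  dependent⇒closure : ∀ {I S e} → Indep I → I ⊆ S → e ∈ E → ¬ Indep (I ∪ ⁅ e ⁆) →
                      Closure S e
  dependent⇒closure {I} {S} {e} iI I⊆S e∈E dep
    with dependent⇒circuit (X∪y⊆Z (indep⊆E iI) e∈E) dep
  ... | C , cC , C⊆I∪e with X⊆Z∪y⇒X-y⊆Z C⊆I∪e | e ∈? C
  ...   | C-e⊆I | yes e∈C = inj₂ (C , cC , e∈C , I⊆S ∘ C-e⊆I)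
  ...   | C-e⊆I | no e∉C  =
    contradiction (indep-⊆ (X-y⊆Z∧y∉X⇒X⊆Z C-e⊆I e∉C) iI) (proj₁ (proj₂ cC))

  -- For `e` outside `S`, extend the rest of the circuit `C` to a base `K` of `M ↾ S`. If
  -- `J ∪ ⁅ e ⁆` were independent, it would be larger than `K` and augment it by some `z`: `z ∈ J`
  -- contradicts the maximality of `K`, and `z = e` puts `C` into an independent set.
  closure⇒dependent : ∀ {J S e} → Matroid.Base (M ↾ S) J → Closure S e → e ∉ J →
                      ¬ Indep (J ∪ ⁅ e ⁆)
  closure⇒dependent ((_ , J⊆S) , maximal) (inj₁ e∈S) e∉J iJ∪e =
    maximal (_ , (iJ∪e , X∪y⊆Z J⊆S e∈S) , I⊂I∪e e∉J)
  closure⇒dependent {J} {S} {e} bJ (inj₂ (C , cC , e∈C , C-e⊆S)) e∉J iJ∪e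
    with Matroid.extend (M ↾ S) (circuit-del cC e∈C , C-e⊆S) bJ
  ... | K , bK@((iK , K⊆S) , maximal) , C-e⊆K , _
    with augment iK iJ∪e (ℕ.≤-<-trans
           (Matroid.∣indep∣≤∣base∣ (M ↾ S) (iK , K⊆S) bJ)
           (p⊂q⇒∣p∣<∣q∣ (I⊂I∪e e∉J)))
  ...   | z , z∈ , z∉K , iK∪z with x∈p∪q⁻ J ⁅ e ⁆ z∈
  ...     | inj₁ z∈J = maximal (_ , (iK∪z , X∪y⊆Z K⊆S (proj₂ (proj₁ bJ) z∈J)) , I⊂I∪e z∉K)
  ...     | inj₂ z∈e with refl ← x∈⁅y⁆⇒x≡y e z∈e =
    proj₁ (proj₂ cC) (indep-⊆ (X-y⊆Z⇒X⊆Z∪y C-e⊆K) iK∪z)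

  -- A base `J` of `M ↾ T` is still a base of `M ↾ (S ∪ T)`, because every element of `S` already
  -- depends on it. Hence `e`, lying in the closure of `S ∪ T`, depends on `J` as well.
  closure-trans : ∀ {S T e} → (∀ {x} → x ∈ S → Closure T x) → Closure S e → Closure T e
  closure-trans S⊆clT (inj₁ e∈S) = S⊆clT e∈S
  closure-trans {S} {T} {e} S⊆clT e∈clS@(inj₂ (C , cC , e∈C , _))
    with Matroid.base-exists (M ↾ T)
  ... | J , bJ@((iJ , J⊆T) , _) with e ∈? J
  ...   | yes e∈J = inj₁ (J⊆T e∈J)
  ...   | no e∉J  = dependent⇒closure iJ J⊆T (proj₁ cC e∈C)
          (closure⇒dependent bJ′ (closure-mono (p⊆p∪q T) e∈clS) e∉J)
    where
    bJ′ : Matroid.Base (M ↾ (S ∪ T)) J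
    bJ′ = (iJ , q⊆p∪q S T ∘ J⊆T) , λ (I , (iI , I⊆) , J⊆I , x , x∈I , x∉J) →
      closure⇒dependent bJ ([ S⊆clT , inj₁ ]′ (x∈p∪q⁻ S T (I⊆ x∈I))) x∉J
        (indep-⊆ (X∪y⊆Z J⊆I x∈I) iI)

  indep⇒∉closure : ∀ {I e} → Indep I → e ∈ I → ¬ Closure (I ∖ e) e
  indep⇒∉closure iI e∈I (inj₁ e∈I-e) = proj₂ (x∈X-y⁻ e∈I-e) refl
  indep⇒∉closure {I} {e} iI e∈I (inj₂ (C , cC , e∈C , C-e⊆)) =
    proj₁ (proj₂ cC) (indep-⊆ C⊆I iI)
    where
    C⊆I : C ⊆ I
    C⊆I x∈C = X∪y⊆Z (proj₁ ∘ x∈X-y⁻) e∈I (X-y⊆Z⇒X⊆Z∪y C-e⊆ x∈C)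

  base⇒spanning : ∀ {B e} → Base B → e ∈ E → Closure B e
  base⇒spanning {B} {e} (iB , maximal) e∈E with e ∈? B
  ... | yes e∈B = inj₁ e∈B
  ... | no e∉B  = dependent⇒closure iB (λ x∈B → x∈B) e∈E λ iB∪e →
    maximal (_ , iB∪e , I⊂I∪e e∉B)

  spanning⇒base : ∀ {B} → Indep B → (∀ {e} → e ∈ E → Closure B e) → Base B
  spanning⇒base iB spanning = maximal⇒base iB λ {x} x∉B iB∪x →
    indep⇒∉closure iB∪x y∈X∪y
      (closure-mono (λ z∈B → x∈p∧x≢y⇒x∈p-y (p⊆p∪q ⁅ x ⁆ z∈B) λ { refl → x∉B z∈B })
                    (spanning (indep⊆E iB∪x y∈X∪y)))

  -- The rest of `D` avoids a base `B`, and the rest of `C` extends inside `C ∪ B` to a base `B′`.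
  -- If `C` and `D` met only in `e`, then `B′` would avoid all of `D`: containing `e` would make `C`
  -- independent. So `D` would be independent in the dual.
  orthogonality : ∀ {C D e} → Circuit C → Matroid.Circuit (M ⋆) D → e ∈ C → e ∈ D →
                  ¬ (∀ {x} → x ∈ C → x ∈ D → x ≡ e)
  orthogonality {C} {D} {e} cC cD@(D⊆E , depD , _) e∈C e∈D C∩D≡e
    with Circuits.circuit-del (M ⋆) cD e∈D
  ... | B , bB , D-e⊆E─B with extend (circuit-del cC e∈C) bB
  ...   | B′ , bB′ , C-e⊆B′ , B′⊆ = depD (B′ , bB′ , λ x∈D → x∈X─Y⁺ (D⊆E x∈D) (x∉B′ x∈D))
    where
    x∉B′ : ∀ {x} → x ∈ D → x ∉ B′
    x∉B′ {x} x∈D x∈B′ with x Fin.≟ e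
    ... | yes refl = proj₁ (proj₂ cC)
      (indep-⊆ (λ z∈C → X∪y⊆Z C-e⊆B′ x∈B′ (X-y⊆Z⇒X⊆Z∪y (λ z∈ → z∈) z∈C)) (proj₁ bB′))
    ... | no x≢e with x∈p∪q⁻ (C ∖ e) B (B′⊆ x∈B′)
    ...   | inj₁ x∈C-e = x≢e (C∩D≡e (proj₁ (x∈X-y⁻ x∈C-e)) x∈D)
    ...   | inj₂ x∈B   = proj₂ (x∈X─Y⁻ (D-e⊆E─B (x∈p∧x≢y⇒x∈p-y x∈D x≢e))) x∈B

  -- A base avoiding `E ─ S` would lie in `S` and span `e`, so `E ─ S` contains a cocircuit `D`. It
  -- passes through `e`, since otherwise `B` would avoid `D`.
  cocircuit-avoiding : ∀ {B S e} → Base B → e ∈ B → B ∖ e ⊆ S → ¬ Closure S e →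
                       ∃ λ D → Matroid.Circuit (M ⋆) D × e ∈ D × D ⊆ E ─ S
  cocircuit-avoiding {B} {S} {e} bB e∈B B-e⊆S e∉clS
    with Circuits.dependent⇒circuit (M ⋆) (p─q⊆p E S) dep
    where
    dep : ¬ Matroid.Indep (M ⋆) (E ─ S)
    dep (B′ , bB′ , E─S⊆) = e∉clS
      (closure-mono B′⊆S (base⇒spanning bB′ (indep⊆E (proj₁ bB) e∈B)))
      where
      B′⊆S : B′ ⊆ S
      B′⊆S {x} x∈B′ = decidable-stable (x ∈? S) λ x∉S →
        proj₂ (x∈X─Y⁻ (E─S⊆ (x∈X─Y⁺ (indep⊆E (proj₁ bB′) x∈B′) x∉S))) x∈B′
  ... | D , cD , D⊆E─S = D , cD , e∈D , D⊆E─S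
    where
    e∈D : e ∈ D
    e∈D = decidable-stable (e ∈? D) λ e∉D → proj₁ (proj₂ cD)
      (B , bB , λ x∈D → let x∈E , x∉S = x∈X─Y⁻ (D⊆E─S x∈D) in
         x∈X─Y⁺ x∈E λ x∈B → x∉S (B-e⊆S (x∈p∧x≢y⇒x∈p-y x∈B λ { refl → e∉D x∈D })))

  -- A dual-independent set strictly larger than `E ─ B` avoids a base `B′`, which would then be
  -- strictly contained in `B`.
  base⋆ : ∀ {B} → Base B → Matroid.Base (M ⋆) (E ─ B)
  base⋆ {B} bB = (B , bB , λ x∈ → x∈) , λ (I , (B′ , bB′ , I⊆) , E─B⊆I , x , x∈I , x∉E─B) →
    proj₂ bB′ (B , proj₁ bB ,
      (λ {z} z∈B′ → decidable-stable (z ∈? B) λ z∉B →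
         proj₂ (x∈X─Y⁻ (I⊆ (E─B⊆I (x∈X─Y⁺ (indep⊆E (proj₁ bB′) z∈B′) z∉B)))) z∈B′) ,
      x ,
      decidable-stable (x ∈? B) (λ x∉B → x∉E─B (x∈X─Y⁺ (proj₁ (x∈X─Y⁻ (I⊆ x∈I))) x∉B)) ,
      proj₂ (x∈X─Y⁻ (I⊆ x∈I)))

-- Activities and the partition into blocks

module Activities {n} (M : Matroid n) {_<_ : Rel (Fin n) p}
                  (isSTO : IsStrictTotalOrder _≡_ _<_) where
  open Matroid M
  open Circuits M
  open Closures M
  open IsStrictTotalOrder isSTO
    using (_<?_; compare; irrefl; asym; isStrictPartialOrder)
    renaming (_≟_ to _≟ₒ_; trans to <-trans)

  above : Fin n → Subset n
  above e = ⟪ e <?_ ⟫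

  -- Cut down to `E`, unlike `above`: it enters closures through unions, and the upward induction in
  -- `greedy-spans` must know that its elements lie in `E`.
  below : Fin n → Subset n
  below e = ⟪ (λ f → f ∈? E ×-dec f <? e) ⟫

  ∈above⁺ : ∀ {e f} → e < f → f ∈ above e
  ∈above⁺ {e} = ∈⟪⟫⁺ (e <?_)

  ∈above⁻ : ∀ {e f} → f ∈ above e → e < f
  ∈above⁻ {e} = ∈⟪⟫⁻ (e <?_)

  ∈below⁺ : ∀ {e f} → f ∈ E → f < e → f ∈ below e
  ∈below⁺ {e} f∈E f<e = ∈⟪⟫⁺ (λ f → f ∈? E ×-dec f <? e) (f∈E , f<e)

  ∈below⁻ : ∀ {e f} → f ∈ below e → f ∈ E × f < e
  ∈below⁻ {e} = ∈⟪⟫⁻ (λ f → f ∈? E ×-dec f <? e)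

  maximal-element : ∀ {S e} → e ∈ S → ∃ λ m → m ∈ S × (∀ {x} → x ∈ S → ¬ m < x)
  maximal-element {S} {e} e∈S = go e (spo-noetherian isStrictPartialOrder e) e∈S
    where
    go : ∀ e → Acc (flip _<_) e → e ∈ S → ∃ λ m → m ∈ S × (∀ {x} → x ∈ S → ¬ m < x)
    go e (acc rec) e∈S with Fin.any? (λ f → f ∈? S ×-dec e <? f)
    ... | yes (f , f∈S , e<f) = go f (rec e<f) f∈S
    ... | no maximal = e , e∈S , λ x∈S e<x → maximal (_ , x∈S , e<x)

  minimal-element : ∀ {S e} → e ∈ S → ∃ λ m → m ∈ S × (∀ {x} → x ∈ S → ¬ x < m)
  minimal-element {S} {e} e∈S = go e (spo-wellFounded isStrictPartialOrder e) e∈S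
    where
    go : ∀ e → Acc _<_ e → e ∈ S → ∃ λ m → m ∈ S × (∀ {x} → x ∈ S → ¬ x < m)
    go e (acc rec) e∈S with Fin.any? (λ f → f ∈? S ×-dec f <? e)
    ... | yes (f , f∈S , f<e) = go f (rec f<e) f∈S
    ... | no minimal = e , e∈S , λ x∈S x<e → minimal (_ , x∈S , x<e)

  ≮∧≢⇒> : ∀ {e f} → ¬ e < f → e ≢ f → f < e
  ≮∧≢⇒> {e} {f} e≮f e≢f with compare e f
  ... | tri< e<f _ _ = contradiction e<f e≮f
  ... | tri≈ _ e≡f _ = contradiction e≡f e≢f
  ... | tri> _ _ f<e = f<e

  -- The common core of external activity and of a violation of compatibility: the inclusion says at
  -- once that the rest of `C` lies in `S` and that `e` is the minimum of `C`.
  ExtActive : Subset n → Fin n → Set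
  ExtActive S e = ∃ λ C → Circuit C × e ∈ C × C ∖ e ⊆ S ∩ above e

  closure⇒extActive : ∀ {S e} → Closure (S ∩ above e) e → ExtActive S e
  closure⇒extActive {S} {e} (inj₁ e∈) =
    contradiction (∈above⁻ (p∩q⊆q S (above e) e∈)) (irrefl refl)
  closure⇒extActive (inj₂ active) = active

  isMin : ∀ {S C e} → e ∈ C → C ∖ e ⊆ S ∩ above e → IsMin isSTO e C
  isMin {S} {C} {e} e∈C C-e⊆ = e∈C , min
    where
    min : ∀ {x} → x ∈ C → e < x ⊎ e ≡ x
    min {x} x∈C with e ≟ₒ x
    ... | yes e≡x = inj₂ e≡x
    ... | no e≢x  = inj₁ (∈above⁻ (p∩q⊆q S (above e) (C-e⊆ (x∈p∧x≢y⇒x∈p-y x∈C (e≢x ∘ sym)))))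

  isMin⇒∈above : ∀ {C e} → IsMin isSTO e C → C ∖ e ⊆ above e
  isMin⇒∈above (_ , min) x∈ with x∈X-y⁻ x∈
  ... | x∈C , x≢e with min x∈C
  ...   | inj₁ e<x = ∈above⁺ e<x
  ...   | inj₂ e≡x = contradiction (sym e≡x) x≢e

  ∈Ext⁺ : ∀ {S e} → e ∈ E → e ∉ S → ExtActive S e → e ∈ Ext isSTO M S
  ∈Ext⁺ {S} {e} e∈E e∉S (C , cC , e∈C , C-e⊆) =
    ∈⟪⟫⁺ (λ e → e ∈? (E ─ S) ×-dec hasCircuitWithMin? isSTO M (S ∪ ⁅ e ⁆) e)
      (x∈X─Y⁺ e∈E e∉S ,
       C , cC , X-y⊆Z⇒X⊆Z∪y (p∩q⊆p S (above e) ∘ C-e⊆) , isMin e∈C C-e⊆)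

  ∈Ext⁻ : ∀ {S e} → e ∈ Ext isSTO M S → e ∈ E × e ∉ S × ExtActive S e
  ∈Ext⁻ {S} {e} e∈
    with ∈⟪⟫⁻ (λ e → e ∈? (E ─ S) ×-dec hasCircuitWithMin? isSTO M (S ∪ ⁅ e ⁆) e) e∈
  ... | e∈E─S , C , cC , C⊆ , min = let e∈E , e∉S = x∈X─Y⁻ e∈E─S in
    e∈E , e∉S , C , cC , proj₁ min , λ x∈ →
      x∈p∩q⁺ (X⊆Z∪y⇒X-y⊆Z C⊆ x∈ , isMin⇒∈above min x∈)

  -- Since `C ⊆ E`, the equation `(E ─ X) ∩ C ≡ ⁅ e ⁆` makes `e` the only element of `C` outside
  -- `X`.
  compatible⁺ : ∀ {X} → (∀ {e} → e ∈ E → e ∉ X → ¬ ExtActive X e) →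
                Compatible isSTO M (E ─ X)
  compatible⁺ {X} inactive (C , cC , e , min , E─X∩C≡e) =
    let e∈E , e∉X = x∈X─Y⁻ (p∩q⊆p (E ─ X) C (subst (e ∈_) (sym E─X∩C≡e) (x∈⁅x⁆ e)))
    in inactive e∈E e∉X (C , cC , proj₁ min , λ {x} x∈ →
         let x∈C , x≢e = x∈X-y⁻ x∈ in
         x∈p∩q⁺ (decidable-stable (x ∈? X) (λ x∉X → x≢e (x∈⁅y⁆⇒x≡y e
                   (subst (x ∈_) E─X∩C≡e (x∈p∩q⁺ (x∈X─Y⁺ (proj₁ cC x∈C) x∉X , x∈C))))) ,
                 isMin⇒∈above min x∈))

  compatible⁻ : ∀ {X e} → Compatible isSTO M (E ─ X) → e ∈ E → e ∉ X → ¬ ExtActive X e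
  compatible⁻ {X} {e} compatible e∈E e∉X (C , cC , e∈C , C-e⊆) =
    compatible (C , cC , e , isMin e∈C C-e⊆ , ⊆-antisym ⊆e e⊆)
    where
    ⊆e : (E ─ X) ∩ C ⊆ ⁅ e ⁆
    ⊆e {x} x∈ with x∈p∩q⁻ (E ─ X) C x∈ | x Fin.≟ e
    ... | _ | yes refl = x∈⁅x⁆ x
    ... | x∈E─X , x∈C | no x≢e = contradiction
      (p∩q⊆p X (above e) (C-e⊆ (x∈p∧x≢y⇒x∈p-y x∈C x≢e))) (proj₂ (x∈X─Y⁻ x∈E─X))
    e⊆ : ⁅ e ⁆ ⊆ (E ─ X) ∩ C
    e⊆ x∈e with refl ← x∈⁅y⁆⇒x≡y e x∈e = x∈p∩q⁺ (x∈X─Y⁺ e∈E e∉X , e∈C)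

  -- Apply `cocircuit-avoiding` to `(B ∖ e) ∪ below e`: avoiding the first part puts the cocircuit
  -- into `(E ─ B) ∪ ⁅ e ⁆`, and avoiding the second makes `e` its minimum.
  ∈Int⁺ : ∀ {B e} → Base B → e ∈ B → ¬ Closure ((B ∖ e) ∪ below e) e → e ∈ Int isSTO M B
  ∈Int⁺ {B} {e} bB e∈B e∉cl
    with cocircuit-avoiding bB e∈B (p⊆p∪q (below e)) e∉cl
  ... | D , cD , e∈D , D⊆ =
    ∈⟪⟫⁺ (λ e → e ∈? B ×-dec hasCircuitWithMin? isSTO (M ⋆) ((E ─ B) ∪ ⁅ e ⁆) e)
      (e∈B , D , cD ,
       X-y⊆Z⇒X⊆Z∪y (λ x∈ → let x∈D , x≢e = x∈X-y⁻ x∈ ; x∈E , x∉ = x∈X─Y⁻ (D⊆ x∈D) in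
         x∈X─Y⁺ x∈E λ x∈B → x∉ (p⊆p∪q (below e) (x∈p∧x≢y⇒x∈p-y x∈B x≢e))) ,
       e∈D , min)
    where
    min : ∀ {x} → x ∈ D → e < x ⊎ e ≡ x
    min {x} x∈D with compare e x
    ... | tri< e<x _ _ = inj₁ e<x
    ... | tri≈ _ e≡x _ = inj₂ e≡x
    ... | tri> _ _ x<e = contradiction
      (q⊆p∪q (B ∖ e) (below e) (∈below⁺ (proj₁ (x∈X─Y⁻ (D⊆ x∈D))) x<e))
      (proj₂ (x∈X─Y⁻ (D⊆ x∈D)))

  -- The cocircuit witnessing activity meets neither `B ∖ e` nor `below e`, so a circuit placing `e`
  -- in the closure would meet it in `e` alone, against `orthogonality`.
  ∈Int⁻ : ∀ {B e} → e ∈ Int isSTO M B → e ∈ B × ¬ Closure ((B ∖ e) ∪ below e) e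
  ∈Int⁻ {B} {e} e∈
    with ∈⟪⟫⁻ (λ e → e ∈? B ×-dec hasCircuitWithMin? isSTO (M ⋆) ((E ─ B) ∪ ⁅ e ⁆) e) e∈
  ... | e∈B , D , cD , D⊆ , e∈D , min = e∈B , e∉cl
    where
    disjoint : ∀ {x} → x ∈ D → x ≢ e → x ∉ (B ∖ e) ∪ below e
    disjoint x∈D x≢e x∈ with x∈p∪q⁻ (B ∖ e) (below e) x∈ | min x∈D
    ... | _ | inj₂ e≡x = x≢e (sym e≡x)
    ... | inj₂ x∈below | inj₁ e<x = asym e<x (proj₂ (∈below⁻ x∈below))
    ... | inj₁ x∈B-e | inj₁ _ = proj₂ (x∈X─Y⁻ (X⊆Z∪y⇒X-y⊆Z D⊆ (x∈p∧x≢y⇒x∈p-y x∈D x≢e)))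
                                      (proj₁ (x∈X-y⁻ x∈B-e))
    e∉cl : ¬ Closure ((B ∖ e) ∪ below e) e
    e∉cl (inj₁ e∈) with x∈p∪q⁻ (B ∖ e) (below e) e∈
    ... | inj₁ e∈B-e   = proj₂ (x∈X-y⁻ e∈B-e) refl
    ... | inj₂ e∈below = irrefl refl (proj₂ (∈below⁻ e∈below))
    e∉cl (inj₂ (C , cC , e∈C , C-e⊆)) = orthogonality cC cD e∈C e∈D λ {x} x∈C x∈D →
      decidable-stable (x Fin.≟ e) λ x≢e →
        disjoint x∈D x≢e (C-e⊆ (x∈p∧x≢y⇒x∈p-y x∈C x≢e))

  -- Inside `X` the scan runs downwards, and outside `X` it then runs upwards. Each test uses all
  -- earlier elements rather than the chosen ones among them, which have the same closure when
  -- `X ⊆ E`; so the choice is a predicate without recursion.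
  greedy? : ∀ X → Decidable λ e → e ∈ E × (e ∈ X × ¬ Closure (X ∩ above e) e ⊎
                                           e ∉ X × ¬ Closure (X ∪ below e) e)
  greedy? X e = e ∈? E ×-dec ((e ∈? X ×-dec ¬? (closure? (X ∩ above e) e)) ⊎-dec
                              (¬? (e ∈? X) ×-dec ¬? (closure? (X ∪ below e) e)))

  greedy : Subset n → Subset n
  greedy X = ⟪ greedy? X ⟫

  -- X = (B ─ I) ∪ Ext B with I = B ─ X ⊆ Int B.
  record Block (B X : Subset n) : Set p where
    field
      missing⊆Int : B ─ X ⊆ Int isSTO M B
      Ext⊆X       : Ext isSTO M B ⊆ X
      X⊆B∪Ext     : X ⊆ B ∪ Ext isSTO M B

  -- From a base and a set in its block: recovery of the base, and the ranks.

  module FromBlock {B X} (bB : Base B) (block : Block B X) where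
    open Block block

    B⊆E : B ⊆ E
    B⊆E = indep⊆E (proj₁ bB)

    X⊆E : X ⊆ E
    X⊆E x∈X = [ B⊆E , proj₁ ∘ ∈Ext⁻ ]′ (x∈p∪q⁻ B (Ext isSTO M B) (X⊆B∪Ext x∈X))

    -- If `e < f`, then `C` places `f` in the closure of `(B ∖ f) ∪ below f`, although `f`, being
    -- missing from `X`, is internally active.
    missing-below : ∀ {C e f} → Circuit C → e ∈ C → C ∖ e ⊆ B → f ∈ C → f ∈ B → f ∉ X →
                    e ≢ f → f < e
    missing-below {C} {e} {f} cC e∈C C-e⊆B f∈C f∈B f∉X = ≮∧≢⇒> λ e<f →
      proj₂ (∈Int⁻ (missing⊆Int (x∈X─Y⁺ f∈B f∉X))) (inj₂ (C , cC , f∈C , C-f⊆ e<f))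
      where
      C-f⊆ : e < f → C ∖ f ⊆ (B ∖ f) ∪ below f
      C-f⊆ e<f {x} x∈ with x∈X-y⁻ x∈ | x Fin.≟ e
      ... | _ | yes refl = q⊆p∪q (B ∖ f) (below f) (∈below⁺ (proj₁ cC e∈C) e<f)
      ... | x∈C , x≢f | no x≢e =
        p⊆p∪q (below f) (x∈p∧x≢y⇒x∈p-y (C-e⊆B (x∈p∧x≢y⇒x∈p-y x∈C x≢e)) x≢f)

    -- The circuit witnessing activity has all its other elements above `e`, while any of them
    -- missing from `X` would be below `e` by `missing-below`. So none is missing.
    Ext-spanned : ∀ {e} → e ∈ Ext isSTO M B → Closure ((B ∩ X) ∩ above e) e
    Ext-spanned {e} e∈Ext with ∈Ext⁻ e∈Ext
    ... | _ , _ , C , cC , e∈C , C-e⊆ = inj₂ (C , cC , e∈C , λ {x} x∈ →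
      let x∈C , x≢e = x∈X-y⁻ x∈ ; x∈B , x∈above = x∈p∩q⁻ B (above e) (C-e⊆ x∈) in
      x∈p∩q⁺ (x∈p∩q⁺ (x∈B , decidable-stable (x ∈? X) λ x∉X →
        asym (∈above⁻ x∈above)
             (missing-below cC e∈C (p∩q⊆p B (above e) ∘ C-e⊆) x∈C x∈B x∉X (x≢e ∘ sym))) ,
        x∈above))

    X-spanned : ∀ {x} → x ∈ X → Closure (B ∩ X) x
    X-spanned {x} x∈X with x∈p∪q⁻ B (Ext isSTO M B) (X⊆B∪Ext x∈X)
    ... | inj₁ x∈B   = inj₁ (x∈p∩q⁺ (x∈B , x∈X))
    ... | inj₂ x∈Ext = closure-mono (p∩q⊆p (B ∩ X) (above x)) (Ext-spanned x∈Ext)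

    above-spanned : ∀ {e x} → x ∈ X ∩ above e → Closure ((B ∩ X) ∩ above e) x
    above-spanned {e} {x} x∈ with x∈p∩q⁻ X (above e) x∈
    ... | x∈X , x∈above with x∈p∪q⁻ B (Ext isSTO M B) (X⊆B∪Ext x∈X)
    ...   | inj₁ x∈B   = inj₁ (x∈p∩q⁺ (x∈p∩q⁺ (x∈B , x∈X) , x∈above))
    ...   | inj₂ x∈Ext = closure-mono
      (λ y∈ → let y∈B∩X , y∈above = x∈p∩q⁻ (B ∩ X) (above x) y∈ in
         x∈p∩q⁺ (y∈B∩X , ∈above⁺ (<-trans (∈above⁻ x∈above) (∈above⁻ y∈above))))
      (Ext-spanned x∈Ext)

    B-independent-above : ∀ {e} → e ∈ B → ¬ Closure (X ∩ above e) e
    B-independent-above {e} e∈B e∈cl = indep⇒∉closure (proj₁ bB) e∈B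
      (closure-mono (λ x∈ → let x∈B∩X , x∈above = x∈p∩q⁻ (B ∩ X) (above e) x∈ in
                       x∈p∧x≢y⇒x∈p-y (p∩q⊆p B X x∈B∩X)
                                     λ { refl → irrefl refl (∈above⁻ x∈above) })
                    (closure-trans above-spanned e∈cl))

    -- `X ∩ above e` lies in the closure of `B ∩ above e`, so activity with respect to `X` passes to
    -- `B`. For `e ∉ B` this gives `e ∈ Ext B ⊆ X`, and for `e ∈ B` it contradicts independence.
    inactive : ∀ {e} → e ∈ E → e ∉ X → ¬ ExtActive X e
    inactive {e} e∈E e∉X active with e ∈? B
    ... | yes e∈B = B-independent-above e∈B (inj₂ active)
    ... | no e∉B  = e∉X (Ext⊆X (∈Ext⁺ e∈E e∉B (closure⇒extActive (closure-mono
      (λ x∈ → let x∈B∩X , x∈above = x∈p∩q⁻ (B ∩ X) (above e) x∈ in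
         x∈p∩q⁺ (p∩q⊆p B X x∈B∩X , x∈above))
      (closure-trans above-spanned (inj₂ active))))))

    missing-independent : ∀ {e} → e ∈ B → e ∉ X → ¬ Closure (X ∪ below e) e
    missing-independent {e} e∈B e∉X e∈cl =
      proj₂ (∈Int⁻ (missing⊆Int (x∈X─Y⁺ e∈B e∉X))) (closure-trans spanned e∈cl)
      where
      spanned : ∀ {x} → x ∈ X ∪ below e → Closure ((B ∖ e) ∪ below e) x
      spanned x∈ with x∈p∪q⁻ X (below e) x∈
      ... | inj₂ x∈below = inj₁ (q⊆p∪q (B ∖ e) (below e) x∈below)
      ... | inj₁ x∈X     = closure-mono
        (λ y∈ → let y∈B , y∈X = x∈p∩q⁻ B X y∈ in
           p⊆p∪q (below e) (x∈p∧x≢y⇒x∈p-y y∈B λ { refl → e∉X y∈X }))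
        (X-spanned x∈X)

    -- In the fundamental circuit of `e` with respect to `B`, the other elements missing from `X`
    -- lie below `e` by `missing-below`.
    excluded-spanned : ∀ {e} → e ∈ E → e ∉ B → e ∉ X → Closure (X ∪ below e) e
    excluded-spanned {e} e∈E e∉B e∉X with base⇒spanning bB e∈E
    ... | inj₁ e∈B = contradiction e∈B e∉B
    ... | inj₂ (C , cC , e∈C , C-e⊆B) = inj₂ (C , cC , e∈C , C-e⊆)
      where
      C-e⊆ : C ∖ e ⊆ X ∪ below e
      C-e⊆ {x} x∈ with x ∈? X | x∈X-y⁻ x∈
      ... | yes x∈X | _ = p⊆p∪q (below e) x∈X
      ... | no x∉X | x∈C , x≢e = q⊆p∪q X (below e) (∈below⁺ (proj₁ cC x∈C)
        (missing-below cC e∈C C-e⊆B x∈C (C-e⊆B x∈) x∉X (x≢e ∘ sym)))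

    -- Makes the base a function of `X`, so that blocks of distinct bases are disjoint.
    B≡greedy : B ≡ greedy X
    B≡greedy = ⊆-antisym B⊆greedy greedy⊆B
      where
      B⊆greedy : B ⊆ greedy X
      B⊆greedy {e} e∈B with e ∈? X
      ... | yes e∈X = ∈⟪⟫⁺ (greedy? X) (B⊆E e∈B , inj₁ (e∈X , B-independent-above e∈B))
      ... | no e∉X  = ∈⟪⟫⁺ (greedy? X) (B⊆E e∈B , inj₂ (e∉X , missing-independent e∈B e∉X))
      greedy⊆B : greedy X ⊆ B
      greedy⊆B {e} e∈ with ∈⟪⟫⁻ (greedy? X) e∈
      ... | e∈E , inj₂ (e∉X , e∉cl) = decidable-stable (e ∈? B) λ e∉B →
        e∉cl (excluded-spanned e∈E e∉B e∉X)
      ... | e∈E , inj₁ (e∈X , e∉cl) with x∈p∪q⁻ B (Ext isSTO M B) (X⊆B∪Ext e∈X)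
      ...   | inj₁ e∈B   = e∈B
      ...   | inj₂ e∈Ext = contradiction
        (closure-mono (λ x∈ → let x∈B∩X , x∈above = x∈p∩q⁻ (B ∩ X) (above e) x∈ in
                         x∈p∩q⁺ (p∩q⊆q B X x∈B∩X , x∈above))
                      (Ext-spanned e∈Ext))
        e∉cl

    base-↾ : Matroid.Base (M ↾ X) (B ∩ X)
    base-↾ = (iB∩X , p∩q⊆q B X) , λ (I , (iI , I⊆X) , B∩X⊆I , x , x∈I , x∉B∩X) →
      indep⇒∉closure iI x∈I (closure-mono
        (λ y∈ → x∈p∧x≢y⇒x∈p-y (B∩X⊆I y∈) λ { refl → x∉B∩X y∈ })
        (X-spanned (I⊆X x∈I)))
      where
      iB∩X : Indep (B ∩ X)
      iB∩X = indep-⊆ (p∩q⊆p B X) (proj₁ bB)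

    -- Contraction is defined through the dual, hence this detour. For maximality, a candidate `x`
    -- to be added lies in `B`. A base `B′` avoiding the enlarged set would be spanned by `B ∖ x`:
    -- its elements in `X` depend on `B ∩ X`, and the others lie in `B ∖ x`. Then `B ∖ x` would span
    -- `x`.
    base-⋆↾ : Matroid.Base (M ⋆ ↾ (E ─ X)) ((E ─ X) ─ B)
    base-⋆↾ = Closures.maximal⇒base (M ⋆ ↾ (E ─ X))
      ((B , bB , λ x∈ → let x∈E─X , x∉B = x∈X─Y⁻ x∈ in
          x∈X─Y⁺ (p─q⊆p E X x∈E─X) x∉B) , p─q⊆p (E ─ X) B)
      maximal
      where
      maximal : ∀ {x} → x ∉ (E ─ X) ─ B →
                ¬ Matroid.Indep (M ⋆ ↾ (E ─ X)) (((E ─ X) ─ B) ∪ ⁅ x ⁆)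
      maximal {x} x∉ ((B′ , bB′ , ⊆E─B′) , ⊆E─X) =
        indep⇒∉closure (proj₁ bB) x∈B
          (closure-trans spanned (base⇒spanning bB′ (B⊆E x∈B)))
        where
        x∈B : x ∈ B
        x∈B = decidable-stable (x ∈? B) λ x∉B → x∉ (x∈X─Y⁺ (⊆E─X y∈X∪y) x∉B)
        x∉X : x ∉ X
        x∉X = proj₂ (x∈X─Y⁻ (⊆E─X y∈X∪y))
        spanned : ∀ {y} → y ∈ B′ → Closure (B ∖ x) y
        spanned {y} y∈B′ with y ∈? X
        ... | yes y∈X = closure-mono
          (λ z∈ → let z∈B , z∈X = x∈p∩q⁻ B X z∈ in
             x∈p∧x≢y⇒x∈p-y z∈B λ { refl → x∉X z∈X })
          (X-spanned y∈X)
        ... | no y∉X = inj₁ (x∈p∧x≢y⇒x∈p-y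
          (decidable-stable (y ∈? B) λ y∉B → proj₂ (x∈X─Y⁻ (⊆E─B′ (p⊆p∪q ⁅ x ⁆
             (x∈X─Y⁺ (x∈X─Y⁺ (indep⊆E (proj₁ bB′) y∈B′) y∉X) y∉B)))) y∈B′)
          λ { refl → proj₂ (x∈X─Y⁻ (⊆E─B′ y∈X∪y)) y∈B′ })

    rank-/ : Matroid.rank (M / X) ≡ ∣ B ─ X ∣
    rank-/ = trans (rank-base (M / X) (Closures.base⋆ (M ⋆ ↾ (E ─ X)) base-⋆↾))
                   (cong ∣_∣ (⊆-antisym ⊆B─X B─X⊆))
      where
      ⊆B─X : (E ∩ (E ─ X)) ─ ((E ─ X) ─ B) ⊆ B ─ X
      ⊆B─X {x} x∈ with x∈X─Y⁻ x∈
      ... | x∈E∩ , x∉ with p∩q⊆q E (E ─ X) x∈E∩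
      ...   | x∈E─X = x∈X─Y⁺ (decidable-stable (x ∈? B) (x∉ ∘ x∈X─Y⁺ x∈E─X))
                             (proj₂ (x∈X─Y⁻ x∈E─X))
      B─X⊆ : B ─ X ⊆ (E ∩ (E ─ X)) ─ ((E ─ X) ─ B)
      B─X⊆ x∈ = let x∈B , x∉X = x∈X─Y⁻ x∈ in
        x∈X─Y⁺ (x∈p∩q⁺ (B⊆E x∈B , x∈X─Y⁺ (B⊆E x∈B) x∉X))
               λ x∈′ → proj₂ (x∈X─Y⁻ x∈′) x∈B

    corank-↾ : Matroid.rank ((M ↾ X) ⋆) ≡ ∣ Ext isSTO M B ∣
    corank-↾ = trans (rank-base ((M ↾ X) ⋆) (Closures.base⋆ (M ↾ X) base-↾))
                     (cong ∣_∣ (⊆-antisym ⊆Ext Ext⊆))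
      where
      ⊆Ext : (E ∩ X) ─ (B ∩ X) ⊆ Ext isSTO M B
      ⊆Ext x∈ with x∈X─Y⁻ x∈
      ... | x∈E∩X , x∉B∩X with p∩q⊆q E X x∈E∩X
      ...   | x∈X with x∈p∪q⁻ B (Ext isSTO M B) (X⊆B∪Ext x∈X)
      ...     | inj₁ x∈B   = contradiction (x∈p∩q⁺ (x∈B , x∈X)) x∉B∩X
      ...     | inj₂ x∈Ext = x∈Ext
      Ext⊆ : Ext isSTO M B ⊆ (E ∩ X) ─ (B ∩ X)
      Ext⊆ x∈Ext = let x∈E , x∉B , _ = ∈Ext⁻ x∈Ext in
        x∈X─Y⁺ (x∈p∩q⁺ (x∈E , Ext⊆X x∈Ext)) (x∉B ∘ p∩q⊆p B X)

  -- From a set with compatible complement to its base.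

  module ToBlock {X} (X⊆E : X ⊆ E) (inactive : ∀ {e} → e ∈ E → e ∉ X → ¬ ExtActive X e) where

    ∈greedy-inside : ∀ {e} → e ∈ greedy X → e ∈ X → ¬ Closure (X ∩ above e) e
    ∈greedy-inside e∈B e∈X with ∈⟪⟫⁻ (greedy? X) e∈B
    ... | _ , inj₁ (_ , e∉cl) = e∉cl
    ... | _ , inj₂ (e∉X , _)  = contradiction e∈X e∉X

    ∈greedy-outside : ∀ {e} → e ∈ greedy X → e ∉ X → ¬ Closure (X ∪ below e) e
    ∈greedy-outside e∈B e∉X with ∈⟪⟫⁻ (greedy? X) e∈B
    ... | _ , inj₁ (e∈X , _)  = contradiction e∈X e∉X
    ... | _ , inj₂ (_ , e∉cl) = e∉cl

    ∉greedy-inside : ∀ {e} → e ∉ greedy X → e ∈ X → Closure (X ∩ above e) e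
    ∉greedy-inside {e} e∉B e∈X = decidable-stable (closure? _ e) λ e∉cl →
      e∉B (∈⟪⟫⁺ (greedy? X) (X⊆E e∈X , inj₁ (e∈X , e∉cl)))

    ∉greedy-outside : ∀ {e} → e ∈ E → e ∉ greedy X → e ∉ X → Closure (X ∪ below e) e
    ∉greedy-outside {e} e∈E e∉B e∉X = decidable-stable (closure? _ e) λ e∉cl →
      e∉B (∈⟪⟫⁺ (greedy? X) (e∈E , inj₂ (e∉X , e∉cl)))

    -- Here `m` is the maximum of `C ─ X`. The circuit places it in the closure of `X ∪ below m`, so
    -- `m` cannot be in `greedy X`.
    last-outside : ∀ {C f} → Circuit C → f ∈ C → f ∉ X →
                   ∃ λ m → m ∈ C × m ∉ X × ¬ m < f × C ∖ m ⊆ X ∪ below m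
    last-outside {C} cC f∈C f∉X with maximal-element (x∈X─Y⁺ f∈C f∉X)
    ... | m , m∈C─X , m-max with x∈X─Y⁻ m∈C─X
    ...   | m∈C , m∉X = m , m∈C , m∉X , m-max (x∈X─Y⁺ f∈C f∉X) , C-m⊆
      where
      C-m⊆ : C ∖ m ⊆ X ∪ below m
      C-m⊆ {x} x∈ with x∈X-y⁻ x∈ | x ∈? X
      ... | _ | yes x∈X = p⊆p∪q (below m) x∈X
      ... | x∈C , x≢m | no x∉X = q⊆p∪q X (below m) (∈below⁺ (proj₁ cC x∈C)
        (≮∧≢⇒> (m-max (x∈X─Y⁺ x∈C x∉X)) (x≢m ∘ sym)))

    -- If `C` leaves `X`, its last element outside `X` fails the greedy test; if `C ⊆ X`, its
    -- minimum does.
    greedy-no-circuit : ∀ {C} → Circuit C → ¬ C ⊆ greedy X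
    greedy-no-circuit {C} cC C⊆B with nonempty? (C ─ X)
    ... | yes (f , f∈C─X) with x∈X─Y⁻ f∈C─X
    ...   | f∈C , f∉X with last-outside cC f∈C f∉X
    ...     | m , m∈C , m∉X , _ , C-m⊆ =
      ∈greedy-outside (C⊆B m∈C) m∉X (inj₂ (C , cC , m∈C , C-m⊆))
    greedy-no-circuit {C} cC C⊆B | no C⊆X with nonempty? C
    ... | no empty = proj₁ (proj₂ cC) (indep-⊆ (λ x∈C → ⊥-elim (empty (_ , x∈C))) indep-⊥)
    ... | yes (f , f∈C) with minimal-element f∈C
    ...   | m , m∈C , m-min =
      ∈greedy-inside (C⊆B m∈C) (∈X m∈C) (inj₂ (C , cC , m∈C , λ x∈ →
        let x∈C , x≢m = x∈X-y⁻ x∈ in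
        x∈p∩q⁺ (∈X x∈C , ∈above⁺ (≮∧≢⇒> (m-min x∈C) x≢m))))
      where
      ∈X : ∀ {x} → x ∈ C → x ∈ X
      ∈X {x} x∈C = decidable-stable (x ∈? X) λ x∉X → C⊆X (x , x∈X─Y⁺ x∈C x∉X)

    greedy-indep : Indep (greedy X)
    greedy-indep = decidable-stable (indep? (greedy X)) λ dep →
      let C , cC , C⊆B = dependent⇒circuit (proj₁ ∘ ∈⟪⟫⁻ (greedy? X)) dep
      in greedy-no-circuit cC C⊆B

    -- Induction from the largest element downwards: an unchosen `x` in `X ∩ above e` is spanned by
    -- chosen elements above `x`, which are also above `e`.
    greedy-spans-above : ∀ {e} → Acc (flip _<_) e → e ∉ greedy X → e ∈ X →
                         Closure (greedy X ∩ above e) e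
    greedy-spans-above {e} (acc rec) e∉B e∈X = closure-trans spanned (∉greedy-inside e∉B e∈X)
      where
      spanned : ∀ {x} → x ∈ X ∩ above e → Closure (greedy X ∩ above e) x
      spanned {x} x∈ with x∈p∩q⁻ X (above e) x∈ | x ∈? greedy X
      ... | _ , x∈above | yes x∈B = inj₁ (x∈p∩q⁺ (x∈B , x∈above))
      ... | x∈X , x∈above | no x∉B = closure-mono
        (λ y∈ → let y∈B , y∈above = x∈p∩q⁻ (greedy X) (above x) y∈ in
           x∈p∩q⁺ (y∈B , ∈above⁺ (<-trans (∈above⁻ x∈above) (∈above⁻ y∈above))))
        (greedy-spans-above (rec (∈above⁻ x∈above)) x∉B x∈X)

    greedy-spans-X : ∀ {e} → e ∈ X → Closure (greedy X) e
    greedy-spans-X {e} e∈X with e ∈? greedy X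
    ... | yes e∈B = inj₁ e∈B
    ... | no e∉B  = closure-mono (p∩q⊆p (greedy X) (above e))
      (greedy-spans-above (spo-noetherian isStrictPartialOrder e) e∉B e∈X)

    -- Induction upwards: an unchosen `e` outside `X` lies in the closure of `X ∪ below e`, where
    -- `X` is already spanned and the induction covers `below e`.
    greedy-spans : ∀ {e} → Acc _<_ e → e ∈ E → Closure (greedy X) e
    greedy-spans {e} (acc rec) e∈E with e ∈? X | e ∈? greedy X
    ... | yes e∈X | _       = greedy-spans-X e∈X
    ... | no _    | yes e∈B = inj₁ e∈B
    ... | no e∉X  | no e∉B  = closure-trans
      ([ greedy-spans-X
       , (λ x∈below → let x∈E , x<e = ∈below⁻ x∈below in greedy-spans (rec x<e) x∈E)
       ]′ ∘ x∈p∪q⁻ X (below e))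
      (∉greedy-outside e∈E e∉B e∉X)

    greedy-base : Base (greedy X)
    greedy-base = spanning⇒base greedy-indep
      (greedy-spans (spo-wellFounded isStrictPartialOrder _))

    greedy-block : Block (greedy X) X
    greedy-block = record
      { missing⊆Int = λ e∈ → let e∈B , e∉X = x∈X─Y⁻ e∈ in
          ∈Int⁺ greedy-base e∈B (missing-independent e∈B e∉X)
      ; Ext⊆X   = λ {e} e∈Ext → decidable-stable (e ∈? X) (Ext-missing e∈Ext)
      ; X⊆B∪Ext = X⊆B∪Ext
      }
      where
      -- The maximum `m` of `C ─ X` is not below `e`, so it is `e` or another chosen element; but a
      -- last element outside `X` is never chosen.
      missing-independent : ∀ {e} → e ∈ greedy X → e ∉ X →
                            ¬ Closure ((greedy X ∖ e) ∪ below e) e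
      missing-independent {e} e∈B e∉X (inj₁ e∈) with x∈p∪q⁻ (greedy X ∖ e) (below e) e∈
      ... | inj₁ e∈B-e   = proj₂ (x∈X-y⁻ e∈B-e) refl
      ... | inj₂ e∈below = irrefl refl (proj₂ (∈below⁻ e∈below))
      missing-independent {e} e∈B e∉X (inj₂ (C , cC , e∈C , C-e⊆))
        with last-outside cC e∈C e∉X
      ... | m , m∈C , m∉X , m≮e , C-m⊆ =
        ∈greedy-outside m∈B m∉X (inj₂ (C , cC , m∈C , C-m⊆))
        where
        m∈B : m ∈ greedy X
        m∈B with m Fin.≟ e
        ... | yes refl = e∈B
        ... | no m≢e with x∈p∪q⁻ (greedy X ∖ e) (below e) (C-e⊆ (x∈p∧x≢y⇒x∈p-y m∈C m≢e))
        ...   | inj₁ m∈B-e   = proj₁ (x∈X-y⁻ m∈B-e)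
        ...   | inj₂ m∈below = contradiction (proj₂ (∈below⁻ m∈below)) m≮e

      -- The last element `m` of `C` outside `X` must be `e`, as the rest of `C` is chosen. That
      -- rest lies above `e`, hence in `X`, and `e` would be active with respect to `X`.
      Ext-missing : ∀ {e} → e ∈ Ext isSTO M (greedy X) → ¬ e ∉ X
      Ext-missing {e} e∈Ext e∉X with ∈Ext⁻ e∈Ext
      ... | e∈E , e∉B , C , cC , e∈C , C-e⊆ with last-outside cC e∈C e∉X
      ...   | m , m∈C , m∉X , m≮e , C-m⊆ with m Fin.≟ e
      ...     | no m≢e = ∈greedy-outside
        (p∩q⊆p (greedy X) (above e) (C-e⊆ (x∈p∧x≢y⇒x∈p-y m∈C m≢e))) m∉X
        (inj₂ (C , cC , m∈C , C-m⊆))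
      ...     | yes refl = inactive e∈E e∉X (C , cC , e∈C , C-e⊆X)
        where
        C-e⊆X : C ∖ e ⊆ X ∩ above e
        C-e⊆X x∈ with p∩q⊆q (greedy X) (above e) (C-e⊆ x∈) | x∈p∪q⁻ X (below e) (C-m⊆ x∈)
        ... | x∈above | inj₁ x∈X     = x∈p∩q⁺ (x∈X , x∈above)
        ... | x∈above | inj₂ x∈below =
          contradiction (proj₂ (∈below⁻ x∈below)) (asym (∈above⁻ x∈above))

      X⊆B∪Ext : X ⊆ greedy X ∪ Ext isSTO M (greedy X)
      X⊆B∪Ext {e} e∈X with e ∈? greedy X
      ... | yes e∈B = p⊆p∪q (Ext isSTO M (greedy X)) e∈B
      ... | no e∉B  = q⊆p∪q (greedy X) (Ext isSTO M (greedy X))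
        (∈Ext⁺ (X⊆E e∈X) e∉B (closure⇒extActive
          (greedy-spans-above (spo-noetherian isStrictPartialOrder e) e∉B e∈X)))

  -- Blocks as intervals of subsets, and the partition.

  blockMin : Subset n → Subset n
  blockMin B = (B ─ Int isSTO M B) ∪ Ext isSTO M B

  blockMax : Subset n → Subset n
  blockMax B = B ∪ Ext isSTO M B

  blockList : Subset n → List (Subset n)
  blockList B = interval (blockMin B) (blockMax B)

  ∈blockList⁺ : ∀ {B X} → Block B X → X ∈ₗ blockList B
  ∈blockList⁺ {B} {X} block = ∈-interval⁺
    ([ (λ e∈ → let e∈B , e∉Int = x∈X─Y⁻ e∈ in
          decidable-stable (_ ∈? X) λ e∉X → e∉Int (missing⊆Int (x∈X─Y⁺ e∈B e∉X)))
     , Ext⊆X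
     ]′ ∘ x∈p∪q⁻ (B ─ Int isSTO M B) (Ext isSTO M B))
    X⊆B∪Ext
    where open Block block

  ∈blockList⁻ : ∀ {B X} → X ∈ₗ blockList B → Block B X
  ∈blockList⁻ {B} {X} X∈ with ∈-interval⁻ (blockMin B) (blockMax B) X∈
  ... | P⊆X , X⊆Q = record
    { missing⊆Int = λ e∈ → let e∈B , e∉X = x∈X─Y⁻ e∈ in
        decidable-stable (_ ∈? Int isSTO M B) λ e∉Int →
          e∉X (P⊆X (p⊆p∪q (Ext isSTO M B) (x∈X─Y⁺ e∈B e∉Int)))
    ; Ext⊆X   = P⊆X ∘ q⊆p∪q (B ─ Int isSTO M B) (Ext isSTO M B)
    ; X⊆B∪Ext = X⊆Q
    }

  compatibleSet? : Decidable λ X → X ⊆ E × Compatible isSTO M (E ─ X)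
  compatibleSet? X = (X ⊆? E) ×-dec compatible? isSTO M (E ─ X)

  -- Crapo: the sets X with compatible complement are partitioned by the upper
  -- parts [(B ─ Int B) ∪ Ext B , B ∪ Ext B] of the intervals [B ─ Int B , B ∪ Ext B].
  compatible↭blocks : filter compatibleSet? (subsets n) ↭
                      concatMap blockList (filter base? (subsets n))
  -- Both lists are free of repetitions, so equality of their members suffices for a permutation.
  compatible↭blocks = ∼bag⇒↭ (unique∧set⇒bag
    (Unique.filter⁺ compatibleSet? (subsets-unique n))
    (Unique.concat⁺ (All.map⁺ (All.universal
                      (λ B → interval-unique (blockMin B) (blockMax B)) bases))
                    (AllPairs.map⁺ (disjoint-blocks bases-are-bases
                                     (Unique.filter⁺ base? (subsets-unique n)))))
    (mk⇔ to from))
    where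
    bases : List (Subset n)
    bases = filter base? (subsets n)

    bases-are-bases : All Base bases
    bases-are-bases = All.all-filter base? (subsets n)

    disjoint-blocks : ∀ {Bs} → All Base Bs → Unique Bs →
                      AllPairs (λ B B′ → Disjoint (blockList B) (blockList B′)) Bs
    disjoint-blocks [] [] = []
    disjoint-blocks {B ∷ Bs} (bB ∷ bBs) (B∉Bs ∷ unique) =
      All.zipWith (λ { (bB′ , B≢B′) (X∈ , X∈′) → B≢B′
        (trans (FromBlock.B≡greedy bB (∈blockList⁻ X∈))
               (sym (FromBlock.B≡greedy bB′ (∈blockList⁻ X∈′)))) })
        (bBs , B∉Bs)
      ∷ disjoint-blocks bBs unique

    to : ∀ {X} → X ∈ₗ filter compatibleSet? (subsets n) → X ∈ₗ concatMap blockList bases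
    to {X} X∈ with ∈-filter⁻ compatibleSet? {xs = subsets n} X∈
    ... | _ , X⊆E , compatible =
      ∈-concat⁺′ (∈blockList⁺ greedy-block)
                 (∈-map⁺ blockList (∈-filter⁺ base? (∈-subsets (greedy X)) greedy-base))
      where open ToBlock X⊆E (compatible⁻ compatible)

    from : ∀ {X} → X ∈ₗ concatMap blockList bases → X ∈ₗ filter compatibleSet? (subsets n)
    from {X} X∈ with ∈-concat⁻′ (List.map blockList bases) X∈
    ... | _ , X∈block , block∈ with ∈-map⁻ blockList block∈
    ...   | B , B∈ , refl =
      ∈-filter⁺ compatibleSet? (∈-subsets X) (X⊆E , compatible⁺ inactive)
      where
      open FromBlock (proj₂ (∈-filter⁻ base? {xs = subsets n} B∈)) (∈blockList⁻ X∈block)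

-- Summation

module Sums {c ℓ} (R : CommutativeRing c ℓ) where
  open CommutativeRing R hiding (zero) renaming (refl to ≈-refl; sym to ≈-sym; trans to ≈-trans)
  open Exp semiring
  open import Relation.Binary.Reasoning.Setoid setoid

  private
    variable
      a : Level
      A A′ : Set a

  -- Unfolds to the same fold as `sumOver`, but over any list, such as a concatenation of blocks.
  ∑ : List A → (A → Carrier) → Carrier
  ∑ xs f = foldr _+_ 0# (List.map f xs)

  ∑-cong : ∀ (xs : List A) {f g} → (∀ {a} → a ∈ₗ xs → f a ≈ g a) → ∑ xs f ≈ ∑ xs g
  ∑-cong []       f≈g = ≈-refl
  ∑-cong (x ∷ xs) f≈g = +-cong (f≈g (here refl)) (∑-cong xs (f≈g ∘ there))

  ∑-++ : ∀ (xs ys : List A) f → ∑ (xs ++ ys) f ≈ ∑ xs f + ∑ ys f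
  ∑-++ []       ys f = ≈-sym (+-identityˡ _)
  ∑-++ (x ∷ xs) ys f = ≈-trans (+-congˡ (∑-++ xs ys f)) (≈-sym (+-assoc _ _ _))

  ∑-map : ∀ (xs : List A) (h : A → A′) f → ∑ (List.map h xs) f ≈ ∑ xs (f ∘ h)
  ∑-map []       h f = ≈-refl
  ∑-map (x ∷ xs) h f = +-congˡ (∑-map xs h f)

  ∑-concatMap : ∀ (xs : List A) (h : A → List A′) f →
                ∑ (concatMap h xs) f ≈ ∑ xs (λ a → ∑ (h a) f)
  ∑-concatMap []       h f = ≈-refl
  ∑-concatMap (x ∷ xs) h f = ≈-trans (∑-++ (h x) _ f) (+-congˡ (∑-concatMap xs h f))

  ∑-*ʳ : ∀ (xs : List A) f z → ∑ xs (λ a → f a * z) ≈ ∑ xs f * z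
  ∑-*ʳ []       f z = ≈-sym (zeroˡ z)
  ∑-*ʳ (x ∷ xs) f z = ≈-trans (+-congˡ (∑-*ʳ xs f z)) (≈-sym (distribʳ z _ _))

  ∑-*ˡ : ∀ (xs : List A) f z → ∑ xs (λ a → z * f a) ≈ z * ∑ xs f
  ∑-*ˡ []       f z = ≈-sym (zeroʳ z)
  ∑-*ˡ (x ∷ xs) f z = ≈-trans (+-congˡ (∑-*ˡ xs f z)) (≈-sym (distribˡ z _ _))

  ∑-↭ : ∀ {xs ys : List A} f → xs ↭ ys → ∑ xs f ≈ ∑ ys f
  ∑-↭ f xs↭ys =
    foldr-commMonoid setoid +-isCommutativeMonoid
      (Permutation.map⁺ (≡-setoid _) setoid (λ { refl → ≈-refl }) (↭⇒↭ₛ xs↭ys))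

  -- The binomial theorem in product form: each element of `Q ─ P` contributes a factor `z` when
  -- left out of `X` and `1#` when put in.
  ∑-interval : ∀ {P Q : Subset n} z → P ⊆ Q →
               ∑ (interval P Q) (λ X → z ^ ∣ Q ─ X ∣) ≈ (1# + z) ^ ∣ Q ─ P ∣
  ∑-interval {P = []} {[]} z P⊆Q = +-identityʳ 1#
  ∑-interval {P = outside ∷ P} {outside ∷ Q} z P⊆Q =
    ≈-trans (∑-map (interval P Q) (outside ∷_) _) (∑-interval z (drop-∷-⊆ P⊆Q))
  ∑-interval {P = inside ∷ P} {inside ∷ Q} z P⊆Q =
    ≈-trans (∑-map (interval P Q) (inside ∷_) _) (∑-interval z (drop-∷-⊆ P⊆Q))
  ∑-interval {P = inside ∷ P} {outside ∷ Q} z P⊆Q with () ← P⊆Q Vec.here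
  ∑-interval {P = outside ∷ P} {inside ∷ Q} z P⊆Q = begin
    ∑ (List.map (outside ∷_) (interval P Q) ++ List.map (inside ∷_) (interval P Q)) weight
      ≈⟨ ∑-++ (List.map (outside ∷_) (interval P Q)) _ weight ⟩
    ∑ (List.map (outside ∷_) (interval P Q)) weight +
    ∑ (List.map (inside ∷_) (interval P Q)) weight
      ≈⟨ +-cong (∑-map (interval P Q) (outside ∷_) weight)
                (∑-map (interval P Q) (inside ∷_) weight) ⟩
    ∑ (interval P Q) (λ X → z * z ^ ∣ Q ─ X ∣) + s
      ≈⟨ +-cong (∑-*ˡ (interval P Q) _ z) (≈-sym (*-identityˡ s)) ⟩
    z * s + 1# * s
      ≈⟨ distribʳ s z 1# ⟨
    (z + 1#) * s
      ≈⟨ *-cong (+-comm z 1#) (∑-interval z (drop-∷-⊆ P⊆Q)) ⟩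
    (1# + z) * (1# + z) ^ ∣ Q ─ P ∣ ∎
    where
    weight : Subset _ → Carrier
    weight X = z ^ ∣ (inside ∷ Q) ─ X ∣
    s : Carrier
    s = ∑ (interval P Q) (λ X → z ^ ∣ Q ─ X ∣)

-- The Tutte polynomial as a sum over blocks.

module Expansion {n} (M : Matroid n) {_<_ : Rel (Fin n) p}
                 (isSTO : IsStrictTotalOrder _≡_ _<_)
                 {c ℓ} (R : CommutativeRing c ℓ) (x y : CommutativeRing.Carrier R) where
  open CommutativeRing R hiding (zero) renaming (refl to ≈-refl; sym to ≈-sym; trans to ≈-trans)
  open Exp semiring
  open Matroid M
  open Activities M isSTO
  open Sums R
  open import Relation.Binary.Reasoning.Setoid setoid

  weight : Subset n → Carrier
  weight X = (x - 1#) ^ Matroid.rank (M / X) * y ^ Matroid.rank ((M ↾ X) ⋆)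

  -- `Ext B` belongs to both ends and is disjoint from `B`. The size of this difference is the
  -- exponent produced by `∑-interval`.
  blockMax─blockMin : ∀ B → blockMax B ─ blockMin B ≡ Int isSTO M B
  blockMax─blockMin B = ⊆-antisym ⊆Int Int⊆
    where
    ⊆Int : blockMax B ─ blockMin B ⊆ Int isSTO M B
    ⊆Int {e} e∈ with x∈X─Y⁻ e∈
    ... | e∈Q , e∉P with x∈p∪q⁻ B (Ext isSTO M B) e∈Q
    ...   | inj₂ e∈Ext = contradiction (q⊆p∪q (B ─ Int isSTO M B) _ e∈Ext) e∉P
    ...   | inj₁ e∈B   = decidable-stable (e ∈? Int isSTO M B) λ e∉Int →
      e∉P (p⊆p∪q (Ext isSTO M B) (x∈X─Y⁺ e∈B e∉Int))
    Int⊆ : Int isSTO M B ⊆ blockMax B ─ blockMin B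
    Int⊆ e∈Int = let e∈B , _ = ∈Int⁻ e∈Int in
      x∈X─Y⁺ (p⊆p∪q (Ext isSTO M B) e∈B)
        ([ (λ e∈ → proj₂ (x∈X─Y⁻ e∈) e∈Int)
         , (λ e∈Ext → proj₁ (proj₂ (∈Ext⁻ e∈Ext)) e∈B)
         ]′ ∘ x∈p∪q⁻ (B ─ Int isSTO M B) (Ext isSTO M B))

  -- Brings the exponent from `rank-/` into the form summed by `∑-interval`.
  blockMax─X : ∀ {B X} → Block B X → blockMax B ─ X ≡ B ─ X
  blockMax─X {B} {X} block = ⊆-antisym
    (λ e∈ → let e∈Q , e∉X = x∈X─Y⁻ e∈ in
       [ (λ e∈B → x∈X─Y⁺ e∈B e∉X)
       , (λ e∈Ext → contradiction (Block.Ext⊆X block e∈Ext) e∉X)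
       ]′ (x∈p∪q⁻ B (Ext isSTO M B) e∈Q))
    (λ e∈ → let e∈B , e∉X = x∈X─Y⁻ e∈ in x∈X─Y⁺ (p⊆p∪q (Ext isSTO M B) e∈B) e∉X)

  weight-block : ∀ {B X} → Base B → Block B X →
                 weight X ≡ (x - 1#) ^ ∣ blockMax B ─ X ∣ * y ^ ∣ Ext isSTO M B ∣
  weight-block bB block = cong₂ (λ i j → (x - 1#) ^ i * y ^ j)
    (trans rank-/ (cong ∣_∣ (sym (blockMax─X block)))) corank-↾
    where open FromBlock bB block

  1+[x-1]≈x : 1# + (x - 1#) ≈ x
  1+[x-1]≈x = begin
    1# + (x - 1#)    ≈⟨ +-comm 1# _ ⟩
    x - 1# + 1#      ≈⟨ +-assoc x _ 1# ⟩
    x + (- 1# + 1#)  ≈⟨ +-congˡ (-‿inverseˡ 1#) ⟩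
    x + 0#           ≈⟨ +-identityʳ x ⟩
    x                ∎

  -- The power of `y` is constant on a block and factors out; the powers of `x - 1#` sum to a power
  -- of `1# + (x - 1#)`, which is `x`.
  ∑-block : ∀ {B} → Base B →
            x ^ ∣ Int isSTO M B ∣ * y ^ ∣ Ext isSTO M B ∣ ≈ ∑ (blockList B) weight
  ∑-block {B} bB = ≈-sym (begin
    ∑ (blockList B) weight
      ≈⟨ ∑-cong (blockList B) (λ X∈ → reflexive (weight-block bB (∈blockList⁻ X∈))) ⟩
    ∑ (blockList B) (λ X → (x - 1#) ^ ∣ blockMax B ─ X ∣ * y ^ ∣ Ext isSTO M B ∣)
      ≈⟨ ∑-*ʳ (blockList B) _ _ ⟩
    ∑ (blockList B) (λ X → (x - 1#) ^ ∣ blockMax B ─ X ∣) * y ^ ∣ Ext isSTO M B ∣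
      ≈⟨ *-congʳ (∑-interval (x - 1#) min⊆max) ⟩
    (1# + (x - 1#)) ^ ∣ blockMax B ─ blockMin B ∣ * y ^ ∣ Ext isSTO M B ∣
      ≈⟨ *-congʳ (^-congˡ ∣ blockMax B ─ blockMin B ∣ 1+[x-1]≈x) ⟩
    x ^ ∣ blockMax B ─ blockMin B ∣ * y ^ ∣ Ext isSTO M B ∣
      ≡⟨ cong (λ I → x ^ ∣ I ∣ * y ^ ∣ Ext isSTO M B ∣) (blockMax─blockMin B) ⟩
    x ^ ∣ Int isSTO M B ∣ * y ^ ∣ Ext isSTO M B ∣ ∎)
    where
    min⊆max : blockMin B ⊆ blockMax B
    min⊆max = [ p⊆p∪q (Ext isSTO M B) ∘ p─q⊆p B (Int isSTO M B)
              , q⊆p∪q B (Ext isSTO M B)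
              ]′ ∘ x∈p∪q⁻ (B ─ Int isSTO M B) (Ext isSTO M B)

  expansion : tutte R isSTO M x y ≈ sumOver R compatibleSet? weight
  expansion = begin
    ∑ bases (λ B → x ^ ∣ Int isSTO M B ∣ * y ^ ∣ Ext isSTO M B ∣)
      ≈⟨ ∑-cong bases (λ B∈ → ∑-block (proj₂ (∈-filter⁻ base? {xs = subsets n} B∈))) ⟩
    ∑ bases (λ B → ∑ (blockList B) weight)
      ≈⟨ ∑-concatMap bases blockList weight ⟨
    ∑ (concatMap blockList bases) weight
      ≈⟨ ∑-↭ weight compatible↭blocks ⟨
    ∑ (filter compatibleSet? (subsets n)) weight ∎
    where
    bases : List (Subset n)
    bases = filter base? (subsets n)

corollary11 :
  ∀ {c ℓ p : Level} {n : ℕ} (M : Matroid n)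
  {_<_ : Rel (Fin n) p} (isSTO : IsStrictTotalOrder _≡_ _<_)
  (R : CommutativeRing c ℓ) (x y : CommutativeRing.Carrier R) →
  let open CommutativeRing R
      open Exp semiring
      open Matroid
  in tutte R isSTO M x y
     ≈ sumOver R (λ X → (X ⊆? E M) ×-dec compatible? isSTO M (E M ─ X))
         (λ X → ((x - 1#) ^ rank (M / X)) * (y ^ rank ((M ↾ X) ⋆)))
corollary11 M isSTO R x y = Expansion.expansion M isSTO R x y
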